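{- For every odd integer $d\geq 5$, one has $$e_r^*(d)\geq \frac{d^2-2d-1}{2d-4}=\frac{d}{2}-\frac{1}{2d-4}.$$
   Context: All polynomials have integer coefficients. For an integer polynomial $P(x)$ of degree $d\ge 2$, let $\mathrm{H}(P)$ denote its naïve height, i.e. the maximum of the absolute values of its coefficients. If $P$ has at least two distinct complex roots, its root separation is $$\mathrm{sep}(P):=\min_{\substack{P(\alpha)=P(\beta)=0,\\ \alpha\neq\beta}}|\alpha-\beta|,$$ where the minimum is over pairs of distinct complex roots of $P$. The quantity $e(P)$ is defined (when $\mathrm{H}(P)>1$) by $\mathrm{sep}(P)=\mathrm{H}(P)^{ -e(P)}$, that is, $e(P)=-\log \mathrm{sep}(P)/\log \mathrm{H}(P)$. For $d\ge 2$, set $$e_r^*(d):=\limsup_{\deg(P)=d,\ \mathrm{H}(P)\to+\infty} e(P)=\lim_{H\to+\infty}\ \sup\{e(P): \deg P=d,\ \mathrm{H}(P)\ge H\},$$ where $P$ ranges over the monic integer polynomials of degree $d$ that are reducible over $\mathbb{Q}$ and have at least two distinct complex roots (the roots are not required to be simple). -}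

module Defs where

open import Data.Integer.Base as ℤ using (ℤ; +_; -[1+_])
open import Data.List.Base using (List; []; _∷_; map; foldr)
open import Data.Nat.Base as ℕ using (ℕ; zero; suc; _⊔_)
import Data.Nat.Properties as ℕ
open import Data.Product.Base using (Σ; Σ-syntax; ∃-syntax; _×_; _,_; proj₁; proj₂)
open import Data.Rational.Base as ℚ
  using (ℚ; 0ℚ; 1ℚ; ½; _/_; ↥_; ↧ₙ_; 1/_; Positive; positive; nonNegative)
import Data.Rational.Properties as ℚ
open import Algebra.Bundles.Raw using (RawRing)
open import Algebra.Bundles using (CommutativeMonoid)
import Algebra.Properties.CommutativeSemigroup as CommutativeSemigroupProperties
import Algebra.Definitions.RawSemiring as RawSemiringDefinitions
open import Relation.Binary.PropositionalEquality
  using (_≡_; sym; trans; cong; cong₂; subst; module ≡-Reasoning)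
open import Relation.Nullary.Negation using (¬_)

open RawSemiringDefinitions (RawRing.rawSemiring ℚ.+-*-rawRing)
  using () renaming (_^_ to _^ℚ_)

ℤ→ℚ : ℤ → ℚ
ℤ→ℚ i = i / 1

-- Real numbers: Cauchy sequences of rationals, compared by the setoid
-- equality _≈ℝ_.

IsCauchy : (ℕ → ℚ) → Set
IsCauchy x = ∀ ε → 0ℚ ℚ.< ε →
  ∃[ N ] (∀ m n → N ℕ.≤ m → N ℕ.≤ n → ℚ.∣ x m ℚ.- x n ∣ ℚ.≤ ε)

record ℝ : Set where
  constructor mkℝ
  field
    seq    : ℕ → ℚ
    cauchy : IsCauchy seq

open ℝ public

module CauchyLemmas where
  half-pos : ∀ ε → 0ℚ ℚ.< ε → 0ℚ ℚ.< ½ ℚ.* ε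
  half-pos ε 0<ε = subst (ℚ._< ½ ℚ.* ε) (ℚ.*-zeroʳ ½) (ℚ.*-monoʳ-<-pos ½ 0<ε)

  half+half : ∀ ε → ½ ℚ.* ε ℚ.+ ½ ℚ.* ε ≡ ε
  half+half ε = trans (sym (ℚ.*-distribʳ-+ ε ½ ½)) (ℚ.*-identityˡ ε)

  module +-CS = CommutativeSemigroupProperties
    (CommutativeMonoid.commutativeSemigroup ℚ.+-0-commutativeMonoid)
  module *-CS = CommutativeSemigroupProperties
    (CommutativeMonoid.commutativeSemigroup ℚ.*-1-commutativeMonoid)

  +-diff : ∀ a b c d → (a ℚ.+ b) ℚ.- (c ℚ.+ d) ≡ (a ℚ.- c) ℚ.+ (b ℚ.- d)
  +-diff a b c d = trans (cong (a ℚ.+ b ℚ.+_) (ℚ.neg-distrib-+ c d))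
    (+-CS.interchange a b (ℚ.- c) (ℚ.- d))

  diff-+ : ∀ a b → (a ℚ.- b) ℚ.+ b ≡ a
  diff-+ a b = trans (ℚ.+-assoc a (ℚ.- b) b)
    (trans (cong (a ℚ.+_) (ℚ.+-inverseˡ b)) (ℚ.+-identityʳ a))

  *-distribˡ-diff : ∀ a b c → a ℚ.* (b ℚ.- c) ≡ a ℚ.* b ℚ.- a ℚ.* c
  *-distribˡ-diff a b c = trans (ℚ.*-distribˡ-+ a b (ℚ.- c))
    (cong (a ℚ.* b ℚ.+_) (sym (ℚ.neg-distribʳ-* a c)))

  *-diff : ∀ a b c d → a ℚ.* b ℚ.- c ℚ.* d ≡ a ℚ.* (b ℚ.- d) ℚ.+ d ℚ.* (a ℚ.- c)
  *-diff a b c d = sym (begin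
    a ℚ.* (b ℚ.- d) ℚ.+ d ℚ.* (a ℚ.- c)
      ≡⟨ cong₂ ℚ._+_ (*-distribˡ-diff a b d) (*-distribˡ-diff d a c) ⟩
    (a ℚ.* b ℚ.- a ℚ.* d) ℚ.+ (d ℚ.* a ℚ.- d ℚ.* c)
      ≡⟨ cong₂ (λ u v → (a ℚ.* b ℚ.- a ℚ.* d) ℚ.+ (u ℚ.- v)) (ℚ.*-comm d a) (ℚ.*-comm d c) ⟩
    (a ℚ.* b ℚ.- a ℚ.* d) ℚ.+ (a ℚ.* d ℚ.- c ℚ.* d)
      ≡⟨ ℚ.+-assoc (a ℚ.* b ℚ.- a ℚ.* d) (a ℚ.* d) (ℚ.- (c ℚ.* d)) ⟨
    ((a ℚ.* b ℚ.- a ℚ.* d) ℚ.+ a ℚ.* d) ℚ.- c ℚ.* d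
      ≡⟨ cong (ℚ._- c ℚ.* d) (diff-+ (a ℚ.* b) (a ℚ.* d)) ⟩
    a ℚ.* b ℚ.- c ℚ.* d ∎)
    where open ≡-Reasoning

  constant-cauchy : ∀ q → IsCauchy (λ _ → q)
  constant-cauchy q ε 0<ε = 0 , λ _ _ _ _ →
    subst (ℚ._≤ ε) (sym (cong ℚ.∣_∣ (ℚ.+-inverseʳ q))) (ℚ.<⇒≤ 0<ε)

  +-cauchy : ∀ x y → IsCauchy x → IsCauchy y → IsCauchy (λ n → x n ℚ.+ y n)
  +-cauchy x y cx cy ε 0<ε
    with cx (½ ℚ.* ε) (half-pos ε 0<ε) | cy (½ ℚ.* ε) (half-pos ε 0<ε)
  ... | M , hx | N , hy = M ⊔ N , λ m n p q → begin
    ℚ.∣ (x m ℚ.+ y m) ℚ.- (x n ℚ.+ y n) ∣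
      ≡⟨ cong ℚ.∣_∣ (+-diff (x m) (y m) (x n) (y n)) ⟩
    ℚ.∣ (x m ℚ.- x n) ℚ.+ (y m ℚ.- y n) ∣
      ≤⟨ ℚ.∣p+q∣≤∣p∣+∣q∣ (x m ℚ.- x n) (y m ℚ.- y n) ⟩
    ℚ.∣ x m ℚ.- x n ∣ ℚ.+ ℚ.∣ y m ℚ.- y n ∣
      ≤⟨ ℚ.+-mono-≤
           (hx m n (ℕ.m⊔n≤o⇒m≤o M N p) (ℕ.m⊔n≤o⇒m≤o M N q))
           (hy m n (ℕ.m⊔n≤o⇒n≤o M N p) (ℕ.m⊔n≤o⇒n≤o M N q)) ⟩
    ½ ℚ.* ε ℚ.+ ½ ℚ.* ε
      ≡⟨ half+half ε ⟩
    ε ∎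
    where open ℚ.≤-Reasoning

  neg-cauchy : ∀ x → IsCauchy x → IsCauchy (λ n → ℚ.- x n)
  neg-cauchy x cx ε 0<ε with cx ε 0<ε
  ... | N , h = N , λ m n p q → begin
    ℚ.∣ (ℚ.- x m) ℚ.- (ℚ.- x n) ∣
      ≡⟨ cong ℚ.∣_∣ (sym (ℚ.neg-distrib-+ (x m) (ℚ.- x n))) ⟩
    ℚ.∣ ℚ.- (x m ℚ.- x n) ∣
      ≡⟨ ℚ.∣-p∣≡∣p∣ (x m ℚ.- x n) ⟩
    ℚ.∣ x m ℚ.- x n ∣
      ≤⟨ h m n p q ⟩
    ε ∎
    where open ℚ.≤-Reasoning

  eventually-bounded : ∀ x → IsCauchy x →
    Σ[ B ∈ ℚ ] 0ℚ ℚ.< B × ∃[ N ] (∀ n → N ℕ.≤ n → ℚ.∣ x n ∣ ℚ.≤ B)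
  eventually-bounded x cx with cx 1ℚ (ℚ.positive⁻¹ 1ℚ)
  ... | N , h = 1ℚ ℚ.+ ℚ.∣ x N ∣
    , ℚ.+-mono-<-≤ (ℚ.positive⁻¹ 1ℚ) (ℚ.0≤∣p∣ (x N))
    , N , λ n p → begin
      ℚ.∣ x n ∣
        ≡⟨ cong ℚ.∣_∣ (sym (diff-+ (x n) (x N))) ⟩
      ℚ.∣ (x n ℚ.- x N) ℚ.+ x N ∣
        ≤⟨ ℚ.∣p+q∣≤∣p∣+∣q∣ (x n ℚ.- x N) (x N) ⟩
      ℚ.∣ x n ℚ.- x N ∣ ℚ.+ ℚ.∣ x N ∣
        ≤⟨ ℚ.+-monoˡ-≤ ℚ.∣ x N ∣ (h n N p ℕ.≤-refl) ⟩
      1ℚ ℚ.+ ℚ.∣ x N ∣ ∎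
    where open ℚ.≤-Reasoning

  *-mono-≤-∣∣ : ∀ p q {r s} → 0ℚ ℚ.≤ r → ℚ.∣ p ∣ ℚ.≤ r → ℚ.∣ q ∣ ℚ.≤ s →
    ℚ.∣ p ℚ.* q ∣ ℚ.≤ r ℚ.* s
  *-mono-≤-∣∣ p q {r} {s} 0≤r p≤r q≤s = begin
    ℚ.∣ p ℚ.* q ∣          ≡⟨ ℚ.∣p*q∣≡∣p∣*∣q∣ p q ⟩
    ℚ.∣ p ∣ ℚ.* ℚ.∣ q ∣    ≤⟨ ℚ.*-monoʳ-≤-nonNeg ℚ.∣ q ∣ {{nonNegative (ℚ.0≤∣p∣ q)}} p≤r ⟩
    r ℚ.* ℚ.∣ q ∣          ≤⟨ ℚ.*-monoˡ-≤-nonNeg r {{nonNegative 0≤r}} q≤s ⟩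
    r ℚ.* s                ∎
    where open ℚ.≤-Reasoning

  *-cauchy : ∀ x y → IsCauchy x → IsCauchy y → IsCauchy (λ n → x n ℚ.* y n)
  *-cauchy x y cx cy ε 0<ε
    with eventually-bounded x cx | eventually-bounded y cy
  ... | B , 0<B , N₁ , hB | C , 0<C , N₂ , hC = N , bound
    where
    open ℚ.≤-Reasoning
    K = B ℚ.+ C
    instance
      K-pos : Positive K
      K-pos = positive (ℚ.+-mono-< 0<B 0<C)
      K-nonZero : ℚ.NonZero K
      K-nonZero = ℚ.pos⇒nonZero K
    δ = ε ℚ.* 1/ K
    0<δ : 0ℚ ℚ.< δ
    0<δ = ℚ.positive⁻¹ δ {{ℚ.pos*pos⇒pos ε {{positive 0<ε}} (1/ K) {{ℚ.1/pos⇒pos K}}}}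
    Kδ≡ε : B ℚ.* δ ℚ.+ C ℚ.* δ ≡ ε
    Kδ≡ε = begin-equality
      B ℚ.* δ ℚ.+ C ℚ.* δ
        ≡⟨ ℚ.*-distribʳ-+ δ B C ⟨
      K ℚ.* (ε ℚ.* 1/ K)  ≡⟨ *-CS.x∙yz≈y∙xz K ε (1/ K) ⟩
      ε ℚ.* (K ℚ.* 1/ K)  ≡⟨ cong (ε ℚ.*_) (ℚ.*-inverseʳ K) ⟩
      ε ℚ.* 1ℚ            ≡⟨ ℚ.*-identityʳ ε ⟩
      ε                   ∎
    N₃ = proj₁ (cx δ 0<δ)
    N₄ = proj₁ (cy δ 0<δ)
    N = (N₁ ⊔ N₂) ⊔ (N₃ ⊔ N₄)
    left : ∀ {m} → N ℕ.≤ m → N₁ ⊔ N₂ ℕ.≤ m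
    left = ℕ.m⊔n≤o⇒m≤o (N₁ ⊔ N₂) (N₃ ⊔ N₄)
    right : ∀ {m} → N ℕ.≤ m → N₃ ⊔ N₄ ℕ.≤ m
    right = ℕ.m⊔n≤o⇒n≤o (N₁ ⊔ N₂) (N₃ ⊔ N₄)
    bound : ∀ m n → N ℕ.≤ m → N ℕ.≤ n →
      ℚ.∣ x m ℚ.* y m ℚ.- x n ℚ.* y n ∣ ℚ.≤ ε
    bound m n p q = begin
      ℚ.∣ x m ℚ.* y m ℚ.- x n ℚ.* y n ∣
        ≡⟨ cong ℚ.∣_∣ (*-diff (x m) (y m) (x n) (y n)) ⟩
      ℚ.∣ x m ℚ.* (y m ℚ.- y n) ℚ.+ y n ℚ.* (x m ℚ.- x n) ∣
        ≤⟨ ℚ.∣p+q∣≤∣p∣+∣q∣ (x m ℚ.* (y m ℚ.- y n)) (y n ℚ.* (x m ℚ.- x n)) ⟩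
      ℚ.∣ x m ℚ.* (y m ℚ.- y n) ∣ ℚ.+ ℚ.∣ y n ℚ.* (x m ℚ.- x n) ∣
        ≤⟨ ℚ.+-mono-≤
             (*-mono-≤-∣∣ (x m) (y m ℚ.- y n) (ℚ.<⇒≤ 0<B)
               (hB m (ℕ.m⊔n≤o⇒m≤o N₁ N₂ (left p)))
               (proj₂ (cy δ 0<δ) m n
                 (ℕ.m⊔n≤o⇒n≤o N₃ N₄ (right p)) (ℕ.m⊔n≤o⇒n≤o N₃ N₄ (right q))))
             (*-mono-≤-∣∣ (y n) (x m ℚ.- x n) (ℚ.<⇒≤ 0<C)
               (hC n (ℕ.m⊔n≤o⇒n≤o N₁ N₂ (left q)))
               (proj₂ (cx δ 0<δ) m n
                 (ℕ.m⊔n≤o⇒m≤o N₃ N₄ (right p)) (ℕ.m⊔n≤o⇒m≤o N₃ N₄ (right q)))) ⟩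
      B ℚ.* δ ℚ.+ C ℚ.* δ
        ≡⟨ Kδ≡ε ⟩
      ε ∎

open CauchyLemmas using (constant-cauchy; +-cauchy; neg-cauchy; *-cauchy)

infixl 6 _+ℝ_ _+ℂ_
infix  8 -ℝ_ -ℂ_
infixl 7 _*ℝ_ _*ℂ_
infix  4 _≈ℝ_ _<ℝ_ _≈ℂ_

ℚ→ℝ : ℚ → ℝ
ℚ→ℝ q = mkℝ (λ _ → q) (constant-cauchy q)

_+ℝ_ : ℝ → ℝ → ℝ
x +ℝ y = mkℝ (λ n → seq x n ℚ.+ seq y n) (+-cauchy (seq x) (seq y) (cauchy x) (cauchy y))

-ℝ_ : ℝ → ℝ
-ℝ x = mkℝ (λ n → ℚ.- seq x n) (neg-cauchy (seq x) (cauchy x))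

_*ℝ_ : ℝ → ℝ → ℝ
x *ℝ y = mkℝ (λ n → seq x n ℚ.* seq y n) (*-cauchy (seq x) (seq y) (cauchy x) (cauchy y))

_≈ℝ_ : ℝ → ℝ → Set
x ≈ℝ y = ∀ ε → 0ℚ ℚ.< ε →
  ∃[ N ] (∀ n → N ℕ.≤ n → ℚ.∣ seq x n ℚ.- seq y n ∣ ℚ.≤ ε)

_<ℝ_ : ℝ → ℝ → Set
x <ℝ y = Σ[ ε ∈ ℚ ] 0ℚ ℚ.< ε ×
  ∃[ N ] (∀ n → N ℕ.≤ n → seq x n ℚ.+ ε ℚ.≤ seq y n)

record ℂ : Set where
  constructor _+i_
  field
    re im : ℝ

open ℂ public

_≈ℂ_ : ℂ → ℂ → Set
z ≈ℂ w = (re z ≈ℝ re w) × (im z ≈ℝ im w)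

_+ℂ_ : ℂ → ℂ → ℂ
z +ℂ w = (re z +ℝ re w) +i (im z +ℝ im w)

-ℂ_ : ℂ → ℂ
-ℂ z = (-ℝ re z) +i (-ℝ im z)

_*ℂ_ : ℂ → ℂ → ℂ
z *ℂ w = (re z *ℝ re w +ℝ -ℝ (im z *ℝ im w)) +i (re z *ℝ im w +ℝ im z *ℝ re w)

ℤ→ℂ : ℤ → ℂ
ℤ→ℂ a = ℚ→ℝ (ℤ→ℚ a) +i ℚ→ℝ 0ℚ

-- ∣ z ∣ < r for the modulus, compared after squaring.

∣_∣<_ : ℂ → ℚ → Set
∣ z ∣< r = 0ℚ ℚ.< r × (re z *ℝ re z +ℝ im z *ℝ im z <ℝ ℚ→ℝ (r ℚ.* r))

-- A polynomial is the list of its coefficients, constant term first.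
-- Trailing zeros are allowed: polynomials p and q are equal when
-- coeff p and coeff q agree.

module Polynomial {a ℓ} (R : RawRing a ℓ) where
  open RawRing R

  coeff : List Carrier → ℕ → Carrier
  coeff []      k       = 0#
  coeff (a ∷ p) zero    = a
  coeff (a ∷ p) (suc k) = coeff p k

  HasDegree : ℕ → List Carrier → Set ℓ
  HasDegree d p = ¬ (coeff p d ≈ 0#) × (∀ k → d ℕ.< k → coeff p k ≈ 0#)

  Monic : ℕ → List Carrier → Set ℓ
  Monic d p = HasDegree d p × coeff p d ≈ 1#

  add : List Carrier → List Carrier → List Carrier
  add []      q       = q
  add (a ∷ p) []      = a ∷ p
  add (a ∷ p) (b ∷ q) = (a + b) ∷ add p q

  mul : List Carrier → List Carrier → List Carrier
  mul []      q = []
  mul (a ∷ p) q = add (map (a *_) q) (0# ∷ mul p q)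

module ℤ[X] = Polynomial ℤ.+-*-rawRing
module ℚ[X] = Polynomial ℚ.+-*-rawRing

ReducibleOverℚ : List ℤ → Set
ReducibleOverℚ P = Σ[ A ∈ List ℚ ] Σ[ B ∈ List ℚ ]
  (∃[ m ] 1 ℕ.≤ m × ℚ[X].HasDegree m A) ×
  (∃[ n ] 1 ℕ.≤ n × ℚ[X].HasDegree n B) ×
  (∀ k → ℚ[X].coeff (ℚ[X].mul A B) k ≡ ℤ→ℚ (ℤ[X].coeff P k))

height : List ℤ → ℕ
height = foldr (λ a h → ℤ.∣ a ∣ ⊔ h) 0

eval : List ℤ → ℂ → ℂ
eval []      z = ℤ→ℂ (+ 0)
eval (a ∷ p) z = ℤ→ℂ a +ℂ z *ℂ eval p z

IsRoot : List ℤ → ℂ → Set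
IsRoot P z = eval P z ≈ℂ ℤ→ℂ (+ 0)

DistinctRoots : List ℤ → ℂ → ℂ → Set
DistinctRoots P α β = IsRoot P α × IsRoot P β × ¬ (α ≈ℂ β)

HasDistinctRoots : List ℤ → Set
HasDistinctRoots P = Σ[ α ∈ ℂ ] Σ[ β ∈ ℂ ] DistinctRoots P α β

-- Elements of [-∞,+∞] obtained as infima or suprema are represented by
-- their rational cuts: x as a LowerCut is the set of rationals q < x,
-- and as an UpperCut the set of rationals r > x.

LowerCut UpperCut : Set₁
LowerCut = ℚ → Set
UpperCut = ℚ → Set

-- A minimum is < r exactly when one of its competitors is.

sep : List ℤ → UpperCut
sep P r = Σ[ α ∈ ℂ ] Σ[ β ∈ ℂ ] DistinctRoots P α β × ∣ α +ℂ -ℂ β ∣< r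

-- For r > 0, H > 0 and q = ↥ q / ↧ₙ q:  r ≤ H^{-q}, with both sides
-- raised to the power ↧ₙ q.

_≤_^-_ : ℚ → ℕ → ℚ → Set
r ≤ H ^- q with ↥ q
... | + a      = (r ^ℚ (↧ₙ q)) ℚ.* ℤ→ℚ (+ (H ℕ.^ a)) ℚ.≤ 1ℚ
... | -[1+ a ] = r ^ℚ (↧ₙ q) ℚ.≤ ℤ→ℚ (+ (H ℕ.^ suc a))

-- e P is defined by sep P = H^{-e P} with H = height P > 1, so q < e P
-- holds exactly when sep P < H^{-q}, i.e. when sep P < r ≤ H^{-q} for
-- some rational r (positive, since sep P < r).

e : List ℤ → LowerCut
e P q = Σ[ r ∈ ℚ ] sep P r × (r ≤ height P ^- q)

sup : {I : Set} → (I → LowerCut) → LowerCut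
sup {I} x q = Σ[ i ∈ I ] x i q

-- The cut of lim x for a sequence x with a limit in [-∞,+∞] (in general,
-- of its lower limit).

lim : (ℕ → LowerCut) → LowerCut
lim x q = Σ[ q′ ∈ ℚ ] q ℚ.< q′ × ∃[ N ] (∀ n → N ℕ.≤ n → x n q′)

infix 4 _≥ᶜ_

_≥ᶜ_ : LowerCut → ℚ → Set
x ≥ᶜ c = ∀ q → q ℚ.< c → x q

record MonicReducible (d H : ℕ) : Set where
  field
    poly             : List ℤ
    monic            : ℤ[X].Monic d poly
    reducible        : ReducibleOverℚ poly
    hasDistinctRoots : HasDistinctRoots poly
    height>1         : 1 ℕ.< height poly
    height≥          : H ℕ.≤ height poly

e*ᵣ : ℕ → LowerCut
e*ᵣ d = lim (λ H → sup {MonicReducible d H} (λ P → e (MonicReducible.poly P)))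

2d∸4-nonZero : ∀ {d} → 5 ℕ.≤ d → ℕ.NonZero (2 ℕ.* d ℕ.∸ 4)
2d∸4-nonZero {d} 5≤d = ℕ.>-nonZero (ℕ.m<n⇒0<n∸m
  (ℕ.≤-trans (ℕ.m≤m+n 5 5) (ℕ.*-monoʳ-≤ 2 5≤d)))

{-# OPTIONS --safe #-}
module Submission where

-- Write d = 2n + 1 and, for a large integer a, let
--   B = x² + aⁿ x − a   and   A = x (x²ⁿ⁻² + a x²ⁿ⁻⁴ + … + aⁿ⁻¹) − 1.
-- Then (x² − a) A = xᵈ − B, so the small positive roots of A and of B are the
-- fixed points of x ↦ (a − x² + s xᵈ) / aⁿ for s = 1 and s = 0.  Both maps
-- contract [0, 1], and both fixed points are about a¹⁻ⁿ, where the two maps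
-- differ by xᵈ / aⁿ ≈ a^-(2n² − 1).  This bounds the distance of the two roots
-- of A B, whose height is O(a²ⁿ⁻¹), and (2n² − 1) / (2n − 1) is the claimed
-- exponent.  Below, m stands for n − 1.

-- Why the division by x² - a: B and xᵈ - B are both perturbations of aⁿ x - a and differ from each
-- other (up to sign) by xᵈ alone, which is tiny at a small root, but their product has degree d +
-- 2. As xᵈ - B = x (x²ⁿ - aⁿ) - (x² - a), the division is exact. It lowers the degree from d to d -
-- 2, which makes room for B, and the height from aⁿ to aⁿ⁻¹. The small root survives, because x² <
-- a there. Each root is given by the rational orbit of 0 under its map, and all estimates are made
-- at every index instead of in the limit. The distance of the two orbits is at most halved in each
-- step, up to an added term xᵈ / aⁿ. This recursion bounds the distance from above. Read in the
-- other direction, with a lower bound for the added term, it shows that the two roots differ,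
-- without which they would say nothing about the separation. Constant factors are harmless: a
-- rational q strictly below the exponent leaves a spare factor a, and a may be taken large in terms
-- of q.

open import Defs
open import Algebra.Bundles using (CommutativeRing)
open import Algebra.Bundles.Raw using (RawRing)
import Algebra.Definitions.RawSemiring as RawSemiringDefinitions
import Algebra.Properties.CommutativeSemiring.Exp as CommutativeSemiringExp
import Algebra.Properties.Semiring.Exp as SemiringExp
open import Data.Integer.Base as ℤ using (ℤ; +_; -[1+_])
import Data.Integer.Properties as ℤ
open import Data.List.Base using (List; []; _∷_; map; length)
open import Data.Nat.Base as ℕ using (ℕ; zero; suc; _⊔_)
open import Data.Nat.Divisibility using (_∣_; ∣m∣n⇒∣m+n; ∣-refl; _∣0)
import Data.Nat.Properties as ℕ
import Data.Nat.Solver as ℕ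
open import Data.Product.Base using (∃-syntax; _×_; _,_; proj₁; proj₂)
open import Data.Rational.Base as ℚ using (ℚ; 0ℚ; 1ℚ; ½; _/_; nonNegative; positive)
import Data.Rational.Properties as ℚ
import Data.Rational.Solver as ℚ
open import Data.Rational.Unnormalised.Base as ℚᵘ using (mkℚᵘ; *≡*; *≤*)
import Data.Rational.Unnormalised.Properties as ℚᵘ
open import Data.Sum.Base using (_⊎_; inj₁; inj₂)
open import Relation.Binary.PropositionalEquality
open import Relation.Nullary.Decidable using (from-yes)
open import Relation.Nullary.Negation using (¬_; contradiction)

open RawSemiringDefinitions (RawRing.rawSemiring ℚ.+-*-rawRing)
  using () renaming (_^_ to _^ℚ_)
open CommutativeSemiringExp (CommutativeRing.commutativeSemiring ℚ.+-*-commutativeRing)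
  using (^-distrib-*)
open SemiringExp (CommutativeRing.semiring ℚ.+-*-commutativeRing)
  using (^-homo-*; ^-assocʳ)

-- With d = 3 + 2m, E = 1 + m + md and L = 1 + 2m, the claimed bound is E / L.
module _ where
  open ℕ.+-*-Solver

  d²≡2E+2d+1 : ∀ m → let d = 3 ℕ.+ (m ℕ.+ m) in
    d ℕ.^ 2 ≡ 2 ℕ.* (suc m ℕ.+ m ℕ.* d) ℕ.+ 2 ℕ.* d ℕ.+ 1
  d²≡2E+2d+1 = solve 1 (λ m → (con 3 :+ (m :+ m)) :^ 2 :=
    con 2 :* (con 1 :+ m :+ m :* (con 3 :+ (m :+ m))) :+ con 2 :* (con 3 :+ (m :+ m)) :+ con 1) refl

  2E+1≡Ld : ∀ m → let d = 3 ℕ.+ (m ℕ.+ m) in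
    2 ℕ.* (suc m ℕ.+ m ℕ.* d) ℕ.+ 1 ≡ (suc m ℕ.+ m) ℕ.* d
  2E+1≡Ld = solve 1 (λ m → con 2 :* (con 1 :+ m :+ m :* (con 3 :+ (m :+ m))) :+ con 1 :=
    (con 1 :+ m :+ m) :* (con 3 :+ (m :+ m))) refl

  2d≡2L+4 : ∀ m → 2 ℕ.* (3 ℕ.+ (m ℕ.+ m)) ≡ 2 ℕ.* (suc m ℕ.+ m) ℕ.+ 4
  2d≡2L+4 = solve 1 (λ m → con 2 :* (con 3 :+ (m :+ m)) := con 2 :* (con 1 :+ m :+ m) :+ con 4) refl

open ℚ.+-*-Solver using (_:+_; _:*_; _:-_; :-_; _:=_; con) renaming (solve to solveℚ)

-- The embedding of ℤ in ℚ

-- `i / 1` is normalised through a gcd. Identities about it are checked on unnormalised fractions,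
-- where they become integer identities after cross multiplication.
toℚᵘ-ℤ→ℚ : ∀ i → ℚ.toℚᵘ (ℤ→ℚ i) ℚᵘ.≃ mkℚᵘ i 0
toℚᵘ-ℤ→ℚ i = ℚ.toℚᵘ-fromℚᵘ (mkℚᵘ i 0)

ℤ→ℚ-homo-+ : ∀ i j → ℤ→ℚ (i ℤ.+ j) ≡ ℤ→ℚ i ℚ.+ ℤ→ℚ j
ℤ→ℚ-homo-+ i j = ℚ.toℚᵘ-injective (begin
  ℚ.toℚᵘ (ℤ→ℚ (i ℤ.+ j))               ≈⟨ toℚᵘ-ℤ→ℚ (i ℤ.+ j) ⟩
  mkℚᵘ (i ℤ.+ j) 0                     ≈⟨ *≡* (cong (ℤ._* + 1) (sym (cong₂ ℤ._+_ (ℤ.*-identityʳ i) (ℤ.*-identityʳ j)))) ⟩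
  mkℚᵘ i 0 ℚᵘ.+ mkℚᵘ j 0               ≈⟨ ℚᵘ.+-cong (toℚᵘ-ℤ→ℚ i) (toℚᵘ-ℤ→ℚ j) ⟨
  ℚ.toℚᵘ (ℤ→ℚ i) ℚᵘ.+ ℚ.toℚᵘ (ℤ→ℚ j)   ≈⟨ ℚ.toℚᵘ-homo-+ (ℤ→ℚ i) (ℤ→ℚ j) ⟨
  ℚ.toℚᵘ (ℤ→ℚ i ℚ.+ ℤ→ℚ j)             ∎)
  where open ℚᵘ.≃-Reasoning

ℤ→ℚ-homo-* : ∀ i j → ℤ→ℚ (i ℤ.* j) ≡ ℤ→ℚ i ℚ.* ℤ→ℚ j
ℤ→ℚ-homo-* i j = ℚ.toℚᵘ-injective (begin
  ℚ.toℚᵘ (ℤ→ℚ (i ℤ.* j))               ≈⟨ toℚᵘ-ℤ→ℚ (i ℤ.* j) ⟩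
  mkℚᵘ (i ℤ.* j) 0                     ≈⟨ *≡* refl ⟩
  mkℚᵘ i 0 ℚᵘ.* mkℚᵘ j 0               ≈⟨ ℚᵘ.*-cong (toℚᵘ-ℤ→ℚ i) (toℚᵘ-ℤ→ℚ j) ⟨
  ℚ.toℚᵘ (ℤ→ℚ i) ℚᵘ.* ℚ.toℚᵘ (ℤ→ℚ j)   ≈⟨ ℚ.toℚᵘ-homo-* (ℤ→ℚ i) (ℤ→ℚ j) ⟨
  ℚ.toℚᵘ (ℤ→ℚ i ℚ.* ℤ→ℚ j)             ∎)
  where open ℚᵘ.≃-Reasoning

ℤ→ℚ-homo-neg : ∀ i → ℤ→ℚ (ℤ.- i) ≡ ℚ.- ℤ→ℚ i
ℤ→ℚ-homo-neg i = ℚ.toℚᵘ-injective (begin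
  ℚ.toℚᵘ (ℤ→ℚ (ℤ.- i))     ≈⟨ toℚᵘ-ℤ→ℚ (ℤ.- i) ⟩
  ℚᵘ.- mkℚᵘ i 0            ≈⟨ ℚᵘ.-‿cong (toℚᵘ-ℤ→ℚ i) ⟨
  ℚᵘ.- ℚ.toℚᵘ (ℤ→ℚ i)      ≈⟨ ℚ.toℚᵘ-homo‿- (ℤ→ℚ i) ⟨
  ℚ.toℚᵘ (ℚ.- ℤ→ℚ i)       ∎)
  where open ℚᵘ.≃-Reasoning

ℤ→ℚ-injective : ∀ {i j} → ℤ→ℚ i ≡ ℤ→ℚ j → i ≡ j
ℤ→ℚ-injective {i} {j} eq with ℚᵘ.≃-trans (ℚᵘ.≃-sym (toℚᵘ-ℤ→ℚ i))
  (ℚᵘ.≃-trans (ℚᵘ.≃-reflexive (cong ℚ.toℚᵘ eq)) (toℚᵘ-ℤ→ℚ j))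
... | *≡* i*1≡j*1 = ℤ.*-cancelʳ-≡ i j (+ 1) i*1≡j*1

ℤ→ℚ-mono-≤ : ∀ {i j} → i ℤ.≤ j → ℤ→ℚ i ℚ.≤ ℤ→ℚ j
ℤ→ℚ-mono-≤ {i} {j} i≤j = ℚ.toℚᵘ-cancel-≤ (ℚᵘ.≤-respʳ-≃ (ℚᵘ.≃-sym (toℚᵘ-ℤ→ℚ j))
  (ℚᵘ.≤-respˡ-≃ (ℚᵘ.≃-sym (toℚᵘ-ℤ→ℚ i)) (*≤* (ℤ.*-monoʳ-≤-nonNeg (+ 1) i≤j))))

-- Integer polynomials

ℤ[X]-map-add : ∀ p q → map ℤ→ℚ (ℤ[X].add p q) ≡ ℚ[X].add (map ℤ→ℚ p) (map ℤ→ℚ q)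
ℤ[X]-map-add []      q       = refl
ℤ[X]-map-add (a ∷ p) []      = refl
ℤ[X]-map-add (a ∷ p) (b ∷ q) = cong₂ _∷_ (ℤ→ℚ-homo-+ a b) (ℤ[X]-map-add p q)

ℤ[X]-map-scale : ∀ a p → map ℤ→ℚ (map (a ℤ.*_) p) ≡ map (ℤ→ℚ a ℚ.*_) (map ℤ→ℚ p)
ℤ[X]-map-scale a []      = refl
ℤ[X]-map-scale a (b ∷ p) = cong₂ _∷_ (ℤ→ℚ-homo-* a b) (ℤ[X]-map-scale a p)

ℤ[X]-map-mul : ∀ p q → map ℤ→ℚ (ℤ[X].mul p q) ≡ ℚ[X].mul (map ℤ→ℚ p) (map ℤ→ℚ q)
ℤ[X]-map-mul []      q = refl
ℤ[X]-map-mul (a ∷ p) q = trans (ℤ[X]-map-add (map (a ℤ.*_) q) (+ 0 ∷ ℤ[X].mul p q))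
  (cong₂ ℚ[X].add (ℤ[X]-map-scale a q) (cong (0ℚ ∷_) (ℤ[X]-map-mul p q)))

coeff-map-ℤ→ℚ : ∀ p k → ℚ[X].coeff (map ℤ→ℚ p) k ≡ ℤ→ℚ (ℤ[X].coeff p k)
coeff-map-ℤ→ℚ []      k       = refl
coeff-map-ℤ→ℚ (a ∷ p) zero    = refl
coeff-map-ℤ→ℚ (a ∷ p) (suc k) = coeff-map-ℤ→ℚ p k

HasDegree-map-ℤ→ℚ : ∀ {d} p → ℤ[X].HasDegree d p → ℚ[X].HasDegree d (map ℤ→ℚ p)
HasDegree-map-ℤ→ℚ {d} p (lead≢0 , above≡0) =
  (λ eq → lead≢0 (ℤ→ℚ-injective (trans (sym (coeff-map-ℤ→ℚ p d)) eq))) ,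
  (λ k d<k → trans (coeff-map-ℤ→ℚ p k) (cong ℤ→ℚ (above≡0 k d<k)))

mul-reducible : ∀ {m n} p q → 1 ℕ.≤ m → 1 ℕ.≤ n →
  ℤ[X].HasDegree m p → ℤ[X].HasDegree n q → ReducibleOverℚ (ℤ[X].mul p q)
mul-reducible p q 1≤m 1≤n degp degq =
  map ℤ→ℚ p , map ℤ→ℚ q ,
  (_ , 1≤m , HasDegree-map-ℤ→ℚ p degp) , (_ , 1≤n , HasDegree-map-ℤ→ℚ q degq) ,
  λ k → trans (cong (λ r → ℚ[X].coeff r k) (sym (ℤ[X]-map-mul p q)))
              (coeff-map-ℤ→ℚ (ℤ[X].mul p q) k)

-- Coefficients and leading terms of products

coeff-add : ∀ p q k → ℤ[X].coeff (ℤ[X].add p q) k ≡ ℤ[X].coeff p k ℤ.+ ℤ[X].coeff q k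
coeff-add []      q       k       = sym (ℤ.+-identityˡ _)
coeff-add (a ∷ p) []      k       = sym (ℤ.+-identityʳ _)
coeff-add (a ∷ p) (b ∷ q) zero    = refl
coeff-add (a ∷ p) (b ∷ q) (suc k) = coeff-add p q k

coeff-scale : ∀ a p k → ℤ[X].coeff (map (a ℤ.*_) p) k ≡ a ℤ.* ℤ[X].coeff p k
coeff-scale a []      k       = sym (ℤ.*-zeroʳ a)
coeff-scale a (b ∷ p) zero    = refl
coeff-scale a (b ∷ p) (suc k) = coeff-scale a p k

record Leading (d : ℕ) (p : List ℤ) : Set where
  constructor leading
  field
    lead≡1  : ℤ[X].coeff p d ≡ + 1
    above≡0 : ∀ k → d ℕ.< k → ℤ[X].coeff p k ≡ + 0

leading⇒monic : ∀ {d p} → Leading d p → ℤ[X].Monic d p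
leading⇒monic {d} {p} (leading lead above) = ((λ eq → 1≢0 (trans (sym lead) eq)) , above) , lead
  where
  1≢0 : + 1 ≢ + 0
  1≢0 ()

leading-∷ : ∀ {d p} a → Leading d p → Leading (suc d) (a ∷ p)
leading-∷ a (leading lead above) = leading lead λ { (suc k) (ℕ.s≤s d<k) → above k d<k }

coeff-mul-∷ : ∀ a p q k → ℤ[X].coeff (ℤ[X].mul (a ∷ p) q) (suc k) ≡
  a ℤ.* ℤ[X].coeff q (suc k) ℤ.+ ℤ[X].coeff (ℤ[X].mul p q) k
coeff-mul-∷ a p q k = trans (coeff-add (map (a ℤ.*_) q) (+ 0 ∷ ℤ[X].mul p q) (suc k))
  (cong (ℤ._+ ℤ[X].coeff (ℤ[X].mul p q) k) (coeff-scale a q (suc k)))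

mul-zeroˡ : ∀ p q → (∀ k → ℤ[X].coeff p k ≡ + 0) → ∀ k → ℤ[X].coeff (ℤ[X].mul p q) k ≡ + 0
mul-zeroˡ []      q p≡0 k = refl
mul-zeroˡ (a ∷ p) q p≡0 zero =
  trans (coeff-add (map (a ℤ.*_) q) _ 0) (cong (ℤ._+ + 0)
    (trans (coeff-scale a q 0) (cong (ℤ._* ℤ[X].coeff q 0) (p≡0 0))))
mul-zeroˡ (a ∷ p) q p≡0 (suc k) = trans (coeff-mul-∷ a p q k)
  (cong₂ ℤ._+_ (cong (ℤ._* ℤ[X].coeff q (suc k)) (p≡0 0))
    (mul-zeroˡ p q (λ i → p≡0 (suc i)) k))

-- Induction on the degree of `p`. Trailing zeros are allowed, so in degree zero the tail of `p`
-- need not be empty: only its coefficients vanish, hence `mul-zeroˡ`.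
leading-mul : ∀ {m n} p q → Leading m p → Leading n q → Leading (m ℕ.+ n) (ℤ[X].mul p q)
leading-mul []      q (leading () _)
leading-mul {zero} {n} (a ∷ p) q (leading refl above) (leading lead′ above′) =
  leading (trans (coefficient n) lead′) (λ k n<k → trans (coefficient k) (above′ k n<k))
  where
  coefficient : ∀ k → ℤ[X].coeff (ℤ[X].mul (a ∷ p) q) k ≡ ℤ[X].coeff q k
  coefficient k = trans (coeff-add (map (a ℤ.*_) q) (+ 0 ∷ ℤ[X].mul p q) k)
    (trans (cong₂ ℤ._+_ (trans (coeff-scale a q k) (ℤ.*-identityˡ _)) (tail≡0 k))
      (ℤ.+-identityʳ _))
    where
    tail≡0 : ∀ k → ℤ[X].coeff (+ 0 ∷ ℤ[X].mul p q) k ≡ + 0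
    tail≡0 zero    = refl
    tail≡0 (suc k) = mul-zeroˡ p q (λ i → above (suc i) ℕ.z<s) k
leading-mul {suc m} {n} (a ∷ p) q (leading lead above) q-leading@(leading _ above′) =
  leading (trans (coefficient ℕ.≤-refl) (Leading.lead≡1 tail))
    λ { (suc k) (ℕ.s<s m+n<k) →
        trans (coefficient (ℕ.<⇒≤ m+n<k)) (Leading.above≡0 tail k m+n<k) }
  where
  tail : Leading (m ℕ.+ n) (ℤ[X].mul p q)
  tail = leading-mul p q (leading lead (λ k m<k → above (suc k) (ℕ.s<s m<k))) q-leading
  -- Position k + 1 exceeds the degree n of `q`, so the row `a` times `q` contributes nothing there.
  coefficient : ∀ {k} → m ℕ.+ n ℕ.≤ k →
    ℤ[X].coeff (ℤ[X].mul (a ∷ p) q) (suc k) ≡ ℤ[X].coeff (ℤ[X].mul p q) k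
  coefficient {k} m+n≤k = trans (coeff-mul-∷ a p q k)
    (trans (cong (ℤ._+ ℤ[X].coeff (ℤ[X].mul p q) k)
      (trans (cong (a ℤ.*_) (above′ (suc k) (ℕ.s≤s (ℕ.≤-trans (ℕ.m≤n+m n m) m+n≤k))))
        (ℤ.*-zeroʳ a)))
      (ℤ.+-identityˡ _))

-- Heights of sums and products

height-add : ∀ p q → height (ℤ[X].add p q) ℕ.≤ height p ℕ.+ height q
height-add []      q       = ℕ.≤-refl
height-add (a ∷ p) []      = ℕ.≤-reflexive (sym (ℕ.+-identityʳ _))
height-add (a ∷ p) (b ∷ q) = ℕ.⊔-lub
  (ℕ.≤-trans (ℤ.∣i+j∣≤∣i∣+∣j∣ a b) (ℕ.+-mono-≤ (ℕ.m≤m⊔n ℤ.∣ a ∣ (height p)) (ℕ.m≤m⊔n ℤ.∣ b ∣ (height q))))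
  (ℕ.≤-trans (height-add p q) (ℕ.+-mono-≤ (ℕ.m≤n⊔m ℤ.∣ a ∣ (height p)) (ℕ.m≤n⊔m ℤ.∣ b ∣ (height q))))

height-scale : ∀ a p → height (map (a ℤ.*_) p) ≡ ℤ.∣ a ∣ ℕ.* height p
height-scale a []      = sym (ℕ.*-zeroʳ ℤ.∣ a ∣)
height-scale a (b ∷ p) = trans (cong₂ _⊔_ (ℤ.∣i*j∣≡∣i∣*∣j∣ a b) (height-scale a p))
  (sym (ℕ.*-distribˡ-⊔ ℤ.∣ a ∣ ℤ.∣ b ∣ (height p)))

-- The product is a sum of one shifted multiple of `q` for each entry of `p`.
height-mul : ∀ p q → height (ℤ[X].mul p q) ℕ.≤ length p ℕ.* (height p ℕ.* height q)
height-mul []      q = ℕ.z≤n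
height-mul (a ∷ p) q = begin
  height (ℤ[X].mul (a ∷ p) q)
    ≤⟨ height-add (map (a ℤ.*_) q) (+ 0 ∷ ℤ[X].mul p q) ⟩
  height (map (a ℤ.*_) q) ℕ.+ height (ℤ[X].mul p q)
    ≤⟨ ℕ.+-mono-≤ (ℕ.≤-reflexive (height-scale a q)) (height-mul p q) ⟩
  ℤ.∣ a ∣ ℕ.* height q ℕ.+ length p ℕ.* (height p ℕ.* height q)
    ≤⟨ ℕ.+-mono-≤ (ℕ.*-monoˡ-≤ (height q) (ℕ.m≤m⊔n ℤ.∣ a ∣ (height p)))
         (ℕ.*-monoʳ-≤ (length p) (ℕ.*-monoˡ-≤ (height q) (ℕ.m≤n⊔m ℤ.∣ a ∣ (height p)))) ⟩
  length (a ∷ p) ℕ.* (height (a ∷ p) ℕ.* height q) ∎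
  where open ℕ.≤-Reasoning

-- Evaluation and real roots

evalℚ : List ℤ → ℚ → ℚ
evalℚ []      x = 0ℚ
evalℚ (a ∷ p) x = ℤ→ℚ a ℚ.+ x ℚ.* evalℚ p x

evalℚ-add : ∀ p q x → evalℚ (ℤ[X].add p q) x ≡ evalℚ p x ℚ.+ evalℚ q x
evalℚ-add []      q       x = sym (ℚ.+-identityˡ _)
evalℚ-add (a ∷ p) []      x = sym (ℚ.+-identityʳ _)
evalℚ-add (a ∷ p) (b ∷ q) x = trans
  (cong₂ (λ s t → s ℚ.+ x ℚ.* t) (ℤ→ℚ-homo-+ a b) (evalℚ-add p q x))
  (solveℚ 5 (λ a b x p q → (a :+ b) :+ x :* (p :+ q) := (a :+ x :* p) :+ (b :+ x :* q)) refl
    (ℤ→ℚ a) (ℤ→ℚ b) x (evalℚ p x) (evalℚ q x))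

evalℚ-scale : ∀ a p x → evalℚ (map (a ℤ.*_) p) x ≡ ℤ→ℚ a ℚ.* evalℚ p x
evalℚ-scale a []      x = sym (ℚ.*-zeroʳ (ℤ→ℚ a))
evalℚ-scale a (b ∷ p) x = trans
  (cong₂ (λ s t → s ℚ.+ x ℚ.* t) (ℤ→ℚ-homo-* a b) (evalℚ-scale a p x))
  (solveℚ 4 (λ a b x p → a :* b :+ x :* (a :* p) := a :* (b :+ x :* p)) refl
    (ℤ→ℚ a) (ℤ→ℚ b) x (evalℚ p x))

evalℚ-mul : ∀ p q x → evalℚ (ℤ[X].mul p q) x ≡ evalℚ p x ℚ.* evalℚ q x
evalℚ-mul []      q x = sym (ℚ.*-zeroˡ (evalℚ q x))
evalℚ-mul (a ∷ p) q x = trans (evalℚ-add (map (a ℤ.*_) q) (+ 0 ∷ ℤ[X].mul p q) x)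
  (trans (cong₂ (λ s t → s ℚ.+ (0ℚ ℚ.+ x ℚ.* t)) (evalℚ-scale a q x) (evalℚ-mul p q x))
  (solveℚ 4 (λ a x p q → a :* q :+ (con 0ℚ :+ x :* (p :* q)) := (a :+ x :* p) :* q) refl
    (ℤ→ℚ a) x (evalℚ p x) (evalℚ q x)))

ℝ→ℂ : ℝ → ℂ
ℝ→ℂ x = x +i ℚ→ℝ 0ℚ

-- Real arithmetic acts termwise on sequences, so at a real point each index sees rational
-- evaluation, and the imaginary part is exactly zero there rather than only in the limit.
eval-ℝ→ℂ : ∀ p x k →
  seq (re (eval p (ℝ→ℂ x))) k ≡ evalℚ p (seq x k) × seq (im (eval p (ℝ→ℂ x))) k ≡ 0ℚ
eval-ℝ→ℂ []      x k = refl , refl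
eval-ℝ→ℂ (a ∷ p) x k with eval-ℝ→ℂ p x k
... | re≡ , im≡ =
  trans (cong₂ (λ s t → ℤ→ℚ a ℚ.+ (seq x k ℚ.* s ℚ.+ ℚ.- (0ℚ ℚ.* t))) re≡ im≡)
    (cong (ℤ→ℚ a ℚ.+_) (ℚ.+-identityʳ _)) ,
  trans (cong₂ (λ s t → 0ℚ ℚ.+ (seq x k ℚ.* s ℚ.+ 0ℚ ℚ.* t)) im≡ re≡)
    (solveℚ 2 (λ x p → con 0ℚ :+ (x :* con 0ℚ :+ con 0ℚ :* p) := con 0ℚ) refl
      (seq x k) (evalℚ p (seq x k)))

realRoot : ∀ p x →
  (∀ ε → 0ℚ ℚ.< ε → ∃[ N ] (∀ k → N ℕ.≤ k → ℚ.∣ evalℚ p (seq x k) ∣ ℚ.≤ ε)) →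
  IsRoot p (ℝ→ℂ x)
realRoot p x p→0 =
  (λ ε 0<ε → proj₁ (p→0 ε 0<ε) , λ k N≤k → subst (λ y → ℚ.∣ y ∣ ℚ.≤ ε)
    (sym (trans (cong (ℚ._- 0ℚ) (proj₁ (eval-ℝ→ℂ p x k))) (ℚ.+-identityʳ _)))
    (proj₂ (p→0 ε 0<ε) k N≤k)) ,
  (λ ε 0<ε → 0 , λ k _ → subst (λ y → ℚ.∣ y ∣ ℚ.≤ ε)
    (sym (cong (ℚ._- 0ℚ) (proj₂ (eval-ℝ→ℂ p x k)))) (ℚ.<⇒≤ 0<ε))

-- Ordered arithmetic and contractions in ℚ

0≤1 : 0ℚ ℚ.≤ 1ℚ
0≤1 = from-yes (0ℚ ℚ.≤? 1ℚ)

0≤ℤ→ℚ : ∀ k → 0ℚ ℚ.≤ ℤ→ℚ (+ k)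
0≤ℤ→ℚ k = ℤ→ℚ-mono-≤ {+ 0} {+ k} (ℤ.+≤+ ℕ.z≤n)

0≤½ : 0ℚ ℚ.≤ ½
0≤½ = from-yes (0ℚ ℚ.≤? ½)

*-monoˡ : ∀ {p q} r → 0ℚ ℚ.≤ r → p ℚ.≤ q → r ℚ.* p ℚ.≤ r ℚ.* q
*-monoˡ r 0≤r = ℚ.*-monoˡ-≤-nonNeg r {{nonNegative 0≤r}}

*-monoʳ : ∀ {p q} r → 0ℚ ℚ.≤ r → p ℚ.≤ q → p ℚ.* r ℚ.≤ q ℚ.* r
*-monoʳ r 0≤r = ℚ.*-monoʳ-≤-nonNeg r {{nonNegative 0≤r}}

*-mono-≤ : ∀ {p q r s} → 0ℚ ℚ.≤ q → 0ℚ ℚ.≤ r → p ℚ.≤ q → r ℚ.≤ s → p ℚ.* r ℚ.≤ q ℚ.* s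
*-mono-≤ {q = q} {r} 0≤q 0≤r p≤q r≤s = ℚ.≤-trans (*-monoʳ r 0≤r p≤q) (*-monoˡ q 0≤q r≤s)

0≤* : ∀ {p q} → 0ℚ ℚ.≤ p → 0ℚ ℚ.≤ q → 0ℚ ℚ.≤ p ℚ.* q
0≤* {p} {q} 0≤p 0≤q = subst (ℚ._≤ p ℚ.* q) (ℚ.*-zeroʳ p) (*-monoˡ p 0≤p 0≤q)

0<* : ∀ {p q} → 0ℚ ℚ.< p → 0ℚ ℚ.< q → 0ℚ ℚ.< p ℚ.* q
0<* {p} {q} 0<p 0<q = subst (ℚ._< p ℚ.* q) (ℚ.*-zeroʳ p)
  (ℚ.*-monoʳ-<-pos p {{positive 0<p}} 0<q)

x≤x+y : ∀ {x y} → 0ℚ ℚ.≤ y → x ℚ.≤ x ℚ.+ y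
x≤x+y {x} 0≤y = subst (ℚ._≤ x ℚ.+ _) (ℚ.+-identityʳ x) (ℚ.+-monoʳ-≤ x 0≤y)

0≤^ : ∀ {x} k → 0ℚ ℚ.≤ x → 0ℚ ℚ.≤ x ^ℚ k
0≤^ zero    0≤x = 0≤1
0≤^ (suc k) 0≤x = 0≤* 0≤x (0≤^ k 0≤x)

0<^ : ∀ {x} k → 0ℚ ℚ.< x → 0ℚ ℚ.< x ^ℚ k
0<^ zero    0<x = ℚ.positive⁻¹ 1ℚ
0<^ (suc k) 0<x = 0<* 0<x (0<^ k 0<x)

^-monoˡ-≤ : ∀ {x y} k → 0ℚ ℚ.≤ x → x ℚ.≤ y → x ^ℚ k ℚ.≤ y ^ℚ k
^-monoˡ-≤ zero    0≤x x≤y = ℚ.≤-refl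
^-monoˡ-≤ (suc k) 0≤x x≤y = *-mono-≤ (ℚ.≤-trans 0≤x x≤y) (0≤^ k 0≤x) x≤y (^-monoˡ-≤ k 0≤x x≤y)

^-≤1 : ∀ {x} k → 0ℚ ℚ.≤ x → x ℚ.≤ 1ℚ → x ^ℚ k ℚ.≤ 1ℚ
^-≤1 zero    0≤x x≤1 = ℚ.≤-refl
^-≤1 (suc k) 0≤x x≤1 = *-mono-≤ 0≤1 (0≤^ k 0≤x) x≤1 (^-≤1 k 0≤x x≤1)

^-antimonoʳ : ∀ {x} j k → 0ℚ ℚ.≤ x → x ℚ.≤ 1ℚ → x ^ℚ (j ℕ.+ k) ℚ.≤ x ^ℚ k
^-antimonoʳ {x} j k 0≤x x≤1 = begin
  x ^ℚ (j ℕ.+ k)        ≡⟨ ^-homo-* x j k ⟩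
  x ^ℚ j ℚ.* x ^ℚ k     ≤⟨ *-monoʳ (x ^ℚ k) (0≤^ k 0≤x) (^-≤1 j 0≤x x≤1) ⟩
  1ℚ ℚ.* x ^ℚ k         ≡⟨ ℚ.*-identityˡ _ ⟩
  x ^ℚ k                ∎
  where open ℚ.≤-Reasoning

-- Powers of one half and the Archimedean property

ℤ→ℚ-homo-^ : ∀ a k → ℤ→ℚ (+ (a ℕ.^ k)) ≡ ℤ→ℚ (+ a) ^ℚ k
ℤ→ℚ-homo-^ a zero    = refl
ℤ→ℚ-homo-^ a (suc k) = trans (cong ℤ→ℚ (ℤ.pos-* a (a ℕ.^ k)))
  (trans (ℤ→ℚ-homo-* (+ a) (+ (a ℕ.^ k))) (cong (ℤ→ℚ (+ a) ℚ.*_) (ℤ→ℚ-homo-^ a k)))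

suc≤2^ : ∀ k → suc k ℕ.≤ 2 ℕ.^ k
suc≤2^ zero    = ℕ.≤-refl
suc≤2^ (suc k) = begin
  suc (suc k)             ≤⟨ ℕ.+-mono-≤ {1} {suc k} {suc k} (ℕ.s≤s ℕ.z≤n) ℕ.≤-refl ⟩
  suc k ℕ.+ suc k         ≤⟨ ℕ.+-mono-≤ (suc≤2^ k) (suc≤2^ k) ⟩
  2 ℕ.^ k ℕ.+ 2 ℕ.^ k     ≡⟨ cong (2 ℕ.^ k ℕ.+_) (sym (ℕ.+-identityʳ _)) ⟩
  2 ℕ.^ suc k             ∎
  where open ℕ.≤-Reasoning

↧*p≡↥ : ∀ p → ℤ→ℚ (ℚ.↧ p) ℚ.* p ≡ ℤ→ℚ (ℚ.↥ p)
↧*p≡↥ p@record{} = ℚ.toℚᵘ-injective (begin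
  ℚ.toℚᵘ (ℤ→ℚ (ℚ.↧ p) ℚ.* p)                ≈⟨ ℚ.toℚᵘ-homo-* (ℤ→ℚ (ℚ.↧ p)) p ⟩
  ℚ.toℚᵘ (ℤ→ℚ (ℚ.↧ p)) ℚᵘ.* ℚ.toℚᵘ p        ≈⟨ ℚᵘ.*-congʳ {ℚ.toℚᵘ p} (toℚᵘ-ℤ→ℚ (ℚ.↧ p)) ⟩
  mkℚᵘ (ℚ.↧ p) 0 ℚᵘ.* ℚ.toℚᵘ p              ≈⟨ *≡* cross ⟩
  mkℚᵘ (ℚ.↥ p) 0                            ≈⟨ toℚᵘ-ℤ→ℚ (ℚ.↥ p) ⟨
  ℚ.toℚᵘ (ℤ→ℚ (ℚ.↥ p))                      ∎)
  where
  open ℚᵘ.≃-Reasoning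
  cross : ℚ.↧ p ℤ.* ℚ.↥ p ℤ.* + 1 ≡ ℚ.↥ p ℤ.* + suc (ℚ.denominator-1 p ℕ.+ 0)
  cross = trans (ℤ.*-identityʳ _) (trans (ℤ.*-comm (ℚ.↧ p) (ℚ.↥ p))
    (cong (λ n → ℚ.↥ p ℤ.* + suc n) (sym (ℕ.+-identityʳ _))))

1/↧≤ : ∀ δ → 0ℚ ℚ.< δ → 1ℚ ℚ.≤ ℤ→ℚ (ℚ.↧ δ) ℚ.* δ
1/↧≤ δ 0<δ = subst (1ℚ ℚ.≤_) (sym (↧*p≡↥ δ)) (ℤ→ℚ-mono-≤ (ℤ.i<j⇒suc[i]≤j 0<↥))
  where
  0<↥ : + 0 ℤ.< ℚ.↥ δ
  0<↥ = subst₂ ℤ._<_ (ℤ.*-zeroˡ (ℚ.↧ δ)) (ℤ.*-identityʳ (ℚ.↥ δ)) (ℚ.drop-*<* 0<δ)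

-- With N the denominator of δ, ½ᴺ ≤ 1 / N because N ≤ 2ᴺ, and 1 / N ≤ δ because a positive
-- numerator is at least 1. This gives an explicit index for every later limit.
½^≤ : ∀ δ → 0ℚ ℚ.< δ → ½ ^ℚ (ℚ.↧ₙ δ) ℚ.≤ δ
½^≤ δ 0<δ = begin
  ½ ^ℚ N                       ≡⟨ ℚ.*-identityʳ _ ⟨
  ½ ^ℚ N ℚ.* 1ℚ                ≤⟨ *-monoˡ (½ ^ℚ N) (0≤^ N 0≤½) (1/↧≤ δ 0<δ) ⟩
  ½ ^ℚ N ℚ.* (ℤ→ℚ (+ N) ℚ.* δ) ≤⟨ *-monoˡ (½ ^ℚ N) (0≤^ N 0≤½) (*-monoʳ δ (ℚ.<⇒≤ 0<δ)
                                    (ℤ→ℚ-mono-≤ (ℤ.+≤+ (ℕ.<⇒≤ (suc≤2^ N))))) ⟩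
  ½ ^ℚ N ℚ.* (ℤ→ℚ (+ (2 ℕ.^ N)) ℚ.* δ) ≡⟨ ℚ.*-assoc (½ ^ℚ N) _ δ ⟨
  ½ ^ℚ N ℚ.* ℤ→ℚ (+ (2 ℕ.^ N)) ℚ.* δ ≡⟨ cong (λ y → ½ ^ℚ N ℚ.* y ℚ.* δ) (ℤ→ℚ-homo-^ 2 N) ⟩
  ½ ^ℚ N ℚ.* ℤ→ℚ (+ 2) ^ℚ N ℚ.* δ ≡⟨ cong (ℚ._* δ) (^-distrib-* ½ (ℤ→ℚ (+ 2)) N) ⟨
  1ℚ ^ℚ N ℚ.* δ ≤⟨ *-monoʳ δ (ℚ.<⇒≤ 0<δ) (^-≤1 N 0≤1 ℚ.≤-refl) ⟩
  1ℚ ℚ.* δ                     ≡⟨ ℚ.*-identityˡ δ ⟩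
  δ                            ∎
  where
  open ℚ.≤-Reasoning
  N = ℚ.↧ₙ δ

½^-antimono : ∀ {j k} → j ℕ.≤ k → ½ ^ℚ k ℚ.≤ ½ ^ℚ j
½^-antimono {j} {k} j≤k = subst (λ i → ½ ^ℚ i ℚ.≤ ½ ^ℚ j) (ℕ.m∸n+n≡m j≤k)
  (^-antimonoʳ (k ℕ.∸ j) j 0≤½ (from-yes (½ ℚ.≤? 1ℚ)))

½^-vanishes : ∀ C → 0ℚ ℚ.< C → ∀ ε → 0ℚ ℚ.< ε →
  ∃[ N ] (∀ k → N ℕ.≤ k → C ℚ.* ½ ^ℚ k ℚ.≤ ε)
½^-vanishes C 0<C ε 0<ε = ℚ.↧ₙ δ , λ k N≤k → begin
  C ℚ.* ½ ^ℚ k            ≤⟨ *-monoˡ C (ℚ.<⇒≤ 0<C) (½^-antimono N≤k) ⟩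
  C ℚ.* ½ ^ℚ (ℚ.↧ₙ δ)     ≤⟨ *-monoˡ C (ℚ.<⇒≤ 0<C) (½^≤ δ 0<δ) ⟩
  C ℚ.* (ℚ.1/ C ℚ.* ε)    ≡⟨ ℚ.*-assoc C (ℚ.1/ C) ε ⟨
  C ℚ.* ℚ.1/ C ℚ.* ε      ≡⟨ cong (ℚ._* ε) (ℚ.*-inverseʳ C) ⟩
  1ℚ ℚ.* ε                ≡⟨ ℚ.*-identityˡ ε ⟩
  ε                       ∎
  where
  open ℚ.≤-Reasoning
  instance
    C-pos : ℚ.Positive C
    C-pos = positive 0<C
    C-nonZero : ℚ.NonZero C
    C-nonZero = ℚ.pos⇒nonZero C
  δ = ℚ.1/ C ℚ.* ε
  0<δ : 0ℚ ℚ.< δ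
  0<δ = 0<* (ℚ.positive⁻¹ (ℚ.1/ C) {{ℚ.1/pos⇒pos C}}) 0<ε

-- Contractions of the unit interval

Unit : ℚ → Set
Unit x = 0ℚ ℚ.≤ x × x ℚ.≤ 1ℚ

unit-∣-∣ : ∀ {x} → Unit x → ℚ.∣ x ∣ ℚ.≤ 1ℚ
unit-∣-∣ (0≤x , x≤1) = subst (ℚ._≤ 1ℚ) (sym (ℚ.0≤p⇒∣p∣≡p 0≤x)) x≤1

∣p∣≤q : ∀ {p q} → p ℚ.≤ q → ℚ.- p ℚ.≤ q → ℚ.∣ p ∣ ℚ.≤ q
∣p∣≤q {p} p≤q -p≤q with ℚ.∣p∣≡p∨∣p∣≡-p p
... | inj₁ eq = subst (ℚ._≤ _) (sym eq) p≤q
... | inj₂ eq = subst (ℚ._≤ _) (sym eq) -p≤q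

unit-distance : ∀ {x y} → Unit x → Unit y → ℚ.∣ x ℚ.- y ∣ ℚ.≤ 1ℚ
unit-distance {x} {y} (0≤x , x≤1) (0≤y , y≤1) = ∣p∣≤q
  (ℚ.+-mono-≤ x≤1 (ℚ.neg-antimono-≤ 0≤y))
  (subst (ℚ._≤ 1ℚ) (solveℚ 2 (λ x y → y :- x := :- (x :- y)) refl x y)
    (ℚ.+-mono-≤ y≤1 (ℚ.neg-antimono-≤ 0≤x)))

unit-^ : ∀ {x} k → Unit x → Unit (x ^ℚ k)
unit-^ k (0≤x , x≤1) = 0≤^ k 0≤x , ^-≤1 k 0≤x x≤1

-- By the product rule xᵏ⁺¹ - yᵏ⁺¹ = (x - y) xᵏ + y (xᵏ - yᵏ), each step of the induction costs one
-- more distance, since all factors lie in the unit interval.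
^-lipschitz : ∀ {x y} k → Unit x → Unit y →
  ℚ.∣ x ^ℚ k ℚ.- y ^ℚ k ∣ ℚ.≤ ℤ→ℚ (+ k) ℚ.* ℚ.∣ x ℚ.- y ∣
^-lipschitz {x} {y} zero    x∈ y∈ = ℚ.≤-reflexive (sym (ℚ.*-zeroˡ ℚ.∣ x ℚ.- y ∣))
^-lipschitz {x} {y} (suc k) x∈ y∈ = begin
  ℚ.∣ x ℚ.* x ^ℚ k ℚ.- y ℚ.* y ^ℚ k ∣
    ≡⟨ cong ℚ.∣_∣ (solveℚ 4 (λ x y X Y → x :* X :- y :* Y := (x :- y) :* X :+ y :* (X :- Y))
         refl x y (x ^ℚ k) (y ^ℚ k)) ⟩
  ℚ.∣ (x ℚ.- y) ℚ.* x ^ℚ k ℚ.+ y ℚ.* (x ^ℚ k ℚ.- y ^ℚ k) ∣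
    ≤⟨ ℚ.∣p+q∣≤∣p∣+∣q∣ ((x ℚ.- y) ℚ.* x ^ℚ k) (y ℚ.* (x ^ℚ k ℚ.- y ^ℚ k)) ⟩
  ℚ.∣ (x ℚ.- y) ℚ.* x ^ℚ k ∣ ℚ.+ ℚ.∣ y ℚ.* (x ^ℚ k ℚ.- y ^ℚ k) ∣
    ≤⟨ ℚ.+-mono-≤
         (CauchyLemmas.*-mono-≤-∣∣ (x ℚ.- y) (x ^ℚ k) (ℚ.0≤∣p∣ (x ℚ.- y)) ℚ.≤-refl (unit-∣-∣ (unit-^ k x∈)))
         (CauchyLemmas.*-mono-≤-∣∣ y (x ^ℚ k ℚ.- y ^ℚ k) 0≤1 (unit-∣-∣ y∈) (^-lipschitz k x∈ y∈)) ⟩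
  ℚ.∣ x ℚ.- y ∣ ℚ.* 1ℚ ℚ.+ 1ℚ ℚ.* (ℤ→ℚ (+ k) ℚ.* ℚ.∣ x ℚ.- y ∣)
    ≡⟨ solveℚ 2 (λ d k → d :* con 1ℚ :+ con 1ℚ :* (k :* d) := (con 1ℚ :+ k) :* d)
         refl ℚ.∣ x ℚ.- y ∣ (ℤ→ℚ (+ k)) ⟩
  (1ℚ ℚ.+ ℤ→ℚ (+ k)) ℚ.* ℚ.∣ x ℚ.- y ∣
    ≡⟨ cong (ℚ._* ℚ.∣ x ℚ.- y ∣) (ℤ→ℚ-homo-+ (+ 1) (+ k)) ⟨
  ℤ→ℚ (+ suc k) ℚ.* ℚ.∣ x ℚ.- y ∣ ∎
  where open ℚ.≤-Reasoning

-- Banach iteration with `g` defined on rationals only. The limit is not shown to be fixed by an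
-- extension of `g`; `residual` says instead that each orbit point is almost fixed, which suffices
-- for polynomial values to tend to zero.
module Contraction (g : ℚ → ℚ) (g-unit : ∀ {x} → Unit x → Unit (g x))
  (g-contracts : ∀ {x y} → Unit x → Unit y → ℚ.∣ g x ℚ.- g y ∣ ℚ.≤ ½ ℚ.* ℚ.∣ x ℚ.- y ∣) where

  orbit : ℕ → ℚ
  orbit zero    = 0ℚ
  orbit (suc k) = g (orbit k)

  orbit-unit : ∀ k → Unit (orbit k)
  orbit-unit zero    = ℚ.≤-refl , 0≤1
  orbit-unit (suc k) = g-unit {orbit k} (orbit-unit k)

  -- The common offset `N` lets the induction peel one `g` off both points until two arbitrary
  -- points of the unit interval remain.
  orbit-contracts : ∀ N i j → ℚ.∣ orbit (N ℕ.+ i) ℚ.- orbit (N ℕ.+ j) ∣ ℚ.≤ ½ ^ℚ N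
  orbit-contracts zero    i j = unit-distance (orbit-unit i) (orbit-unit j)
  orbit-contracts (suc N) i j = ℚ.≤-trans
    (g-contracts {orbit (N ℕ.+ i)} {orbit (N ℕ.+ j)} (orbit-unit (N ℕ.+ i)) (orbit-unit (N ℕ.+ j)))
    (*-monoˡ ½ 0≤½ (orbit-contracts N i j))

  residual : ∀ k → ℚ.∣ g (orbit k) ℚ.- orbit k ∣ ℚ.≤ ½ ^ℚ k
  residual k = subst₂ (λ i j → ℚ.∣ orbit i ℚ.- orbit j ∣ ℚ.≤ ½ ^ℚ k)
    (ℕ.+-comm k 1) (ℕ.+-identityʳ k) (orbit-contracts k 1 0)

  orbit-cauchy : IsCauchy orbit
  orbit-cauchy ε 0<ε = N , λ i j N≤i N≤j → begin
    ℚ.∣ orbit i ℚ.- orbit j ∣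
      ≡⟨ cong₂ (λ k l → ℚ.∣ orbit k ℚ.- orbit l ∣) (ℕ.m+[n∸m]≡n N≤i) (ℕ.m+[n∸m]≡n N≤j) ⟨
    ℚ.∣ orbit (N ℕ.+ (i ℕ.∸ N)) ℚ.- orbit (N ℕ.+ (j ℕ.∸ N)) ∣
      ≤⟨ orbit-contracts N (i ℕ.∸ N) (j ℕ.∸ N) ⟩
    ½ ^ℚ N
      ≤⟨ ½^≤ ε 0<ε ⟩
    ε ∎
    where
    open ℚ.≤-Reasoning
    N = ℚ.↧ₙ ε

  fixedPoint : ℝ
  fixedPoint = mkℝ orbit orbit-cauchy

-- The family of polynomials and its two close roots

-- The exact quotient of x²ᵐ⁺² - aᵐ⁺¹ by x² - a, as `evalℚ-geometric` confirms.
geometric : ℕ → ℕ → List ℤ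
geometric a zero    = + 1 ∷ []
geometric a (suc m) = + (a ℕ.^ suc m) ∷ + 0 ∷ geometric a m

factorA factorB : ℕ → ℕ → List ℤ
factorA a m = ℤ.- + 1 ∷ geometric a m
factorB a m = ℤ.- + a ∷ + (a ℕ.^ suc m) ∷ + 1 ∷ []

geometric-leading : ∀ a m → Leading (m ℕ.+ m) (geometric a m)
geometric-leading a zero    = leading refl λ { (suc k) _ → refl }
geometric-leading a (suc m) rewrite ℕ.+-suc m m =
  leading-∷ (+ (a ℕ.^ suc m)) (leading-∷ (+ 0) (geometric-leading a m))

factorA-leading : ∀ a m → Leading (suc (m ℕ.+ m)) (factorA a m)
factorA-leading a m = leading-∷ (ℤ.- + 1) (geometric-leading a m)

factorB-leading : ∀ a m → Leading 2 (factorB a m)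
factorB-leading a m = leading refl λ { _ (ℕ.s≤s (ℕ.s≤s (ℕ.s≤s _))) → refl }

height-geometric : ∀ a m .{{_ : ℕ.NonZero a}} → height (geometric a m) ℕ.≤ a ℕ.^ m
height-geometric a zero    = ℕ.≤-refl
height-geometric a (suc m) = ℕ.⊔-lub ℕ.≤-refl
  (ℕ.≤-trans (height-geometric a m) (ℕ.^-monoʳ-≤ a (ℕ.n≤1+n m)))

height-factorA : ∀ a m .{{_ : ℕ.NonZero a}} → height (factorA a m) ℕ.≤ a ℕ.^ m
height-factorA a m = ℕ.⊔-lub (ℕ.m^n>0 a m) (height-geometric a m)

height-factorB : ∀ a m .{{_ : ℕ.NonZero a}} → height (factorB a m) ℕ.≤ a ℕ.^ suc m
height-factorB a m = ℕ.⊔-lub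
  (subst₂ ℕ._≤_ (trans (ℕ.^-identityʳ a) (sym (ℤ.∣-i∣≡∣i∣ (+ a)))) refl
    (ℕ.^-monoʳ-≤ a (ℕ.s≤s (ℕ.z≤n {m}))))
  (ℕ.⊔-lub ℕ.≤-refl (ℕ.m^n>0 a (suc m)))

-- `height-mul` counts the length of the first factor; with B in that place the constant is 3 for
-- every `m`.
family : ℕ → ℕ → List ℤ
family a m = ℤ[X].mul (factorB a m) (factorA a m)

height-family-≤ : ∀ a m .{{_ : ℕ.NonZero a}} →
  height (family a m) ℕ.≤ 3 ℕ.* a ℕ.^ (suc m ℕ.+ m)
height-family-≤ a m = begin
  height (family a m)
    ≤⟨ height-mul (factorB a m) (factorA a m) ⟩
  3 ℕ.* (height (factorB a m) ℕ.* height (factorA a m))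
    ≤⟨ ℕ.*-monoʳ-≤ 3 (ℕ.*-mono-≤ (height-factorB a m) (height-factorA a m)) ⟩
  3 ℕ.* (a ℕ.^ suc m ℕ.* a ℕ.^ m)
    ≡⟨ cong (3 ℕ.*_) (ℕ.^-distribˡ-+-* a (suc m) m) ⟨
  3 ℕ.* a ℕ.^ (suc m ℕ.+ m) ∎
  where open ℕ.≤-Reasoning

-- The constant coefficient (-a)(-1) already has this size. The bound is far from sharp, but it
-- makes the height grow with `a`.
height-family-≥ : ∀ a m → a ℕ.≤ height (family a m)
height-family-≥ a m = subst (ℕ._≤ height (family a m)) constant≡a (ℕ.m≤m⊔n ℤ.∣ (ℤ.- + a) ℤ.* (ℤ.- + 1) ℤ.+ + 0 ∣ _)
  where
  constant≡a : ℤ.∣ (ℤ.- + a) ℤ.* (ℤ.- + 1) ℤ.+ + 0 ∣ ≡ a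
  constant≡a = trans (cong ℤ.∣_∣ (ℤ.+-identityʳ ((ℤ.- + a) ℤ.* (ℤ.- + 1)))) (trans (ℤ.∣i*j∣≡∣i∣*∣j∣ (ℤ.- + a) (ℤ.- + 1))
    (trans (ℕ.*-identityʳ _) (ℤ.∣-i∣≡∣i∣ (+ a))))

evalℚ-geometric : ∀ a m x → (x ℚ.* x ℚ.- ℤ→ℚ (+ a)) ℚ.* evalℚ (geometric a m) x ≡
  (x ℚ.* x) ^ℚ suc m ℚ.- ℤ→ℚ (+ a) ^ℚ suc m
evalℚ-geometric a zero x =
  solveℚ 2 (λ x w → (x :* x :- w) :* (con 1ℚ :+ x :* con 0ℚ) :=
                    (x :* x) :* con 1ℚ :- w :* con 1ℚ) refl x (ℤ→ℚ (+ a))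
evalℚ-geometric a (suc m) x = begin
  (x ℚ.* x ℚ.- w) ℚ.* (ℤ→ℚ (+ (a ℕ.^ suc m)) ℚ.+ x ℚ.* (0ℚ ℚ.+ x ℚ.* p))
    ≡⟨ cong (λ c → (x ℚ.* x ℚ.- w) ℚ.* (c ℚ.+ x ℚ.* (0ℚ ℚ.+ x ℚ.* p))) (ℤ→ℚ-homo-^ a (suc m)) ⟩
  (x ℚ.* x ℚ.- w) ℚ.* (W ℚ.+ x ℚ.* (0ℚ ℚ.+ x ℚ.* p))
    ≡⟨ solveℚ 4 (λ x w p W → (x :* x :- w) :* (W :+ x :* (con 0ℚ :+ x :* p)) :=
         x :* x :* ((x :* x :- w) :* p) :+ (x :* x :- w) :* W) refl x w p W ⟩
  x ℚ.* x ℚ.* ((x ℚ.* x ℚ.- w) ℚ.* p) ℚ.+ (x ℚ.* x ℚ.- w) ℚ.* W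
    ≡⟨ cong (λ c → x ℚ.* x ℚ.* c ℚ.+ (x ℚ.* x ℚ.- w) ℚ.* W) (evalℚ-geometric a m x) ⟩
  x ℚ.* x ℚ.* (X ℚ.- W) ℚ.+ (x ℚ.* x ℚ.- w) ℚ.* W
    ≡⟨ solveℚ 4 (λ x w X W → x :* x :* (X :- W) :+ (x :* x :- w) :* W := x :* x :* X :- w :* W)
         refl x w X W ⟩
  x ℚ.* x ℚ.* X ℚ.- w ℚ.* W ∎
  where
  open ≡-Reasoning
  w = ℤ→ℚ (+ a)
  W = w ^ℚ suc m
  X = (x ℚ.* x) ^ℚ suc m
  p = evalℚ (geometric a m) x

-- The two fixed points and their distance

module Roots (a m : ℕ) (4m+10≤a : 2 ℕ.* (5 ℕ.+ (m ℕ.+ m)) ℕ.≤ a)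
  (u : ℚ) (0<u : 0ℚ ℚ.< u) (w*u≡1 : ℤ→ℚ (+ a) ℚ.* u ≡ 1ℚ) where

  private
    n K : ℕ
    n = suc m
    K = 3 ℕ.+ (m ℕ.+ m)

    w : ℚ
    w = ℤ→ℚ (+ a)

  0≤u : 0ℚ ℚ.≤ u
  0≤u = ℚ.<⇒≤ 0<u

  0≤w : 0ℚ ℚ.≤ w
  0≤w = 0≤ℤ→ℚ a

  2≤w : ℤ→ℚ (+ 2) ℚ.≤ w
  2≤w = ℤ→ℚ-mono-≤ (ℤ.+≤+ (ℕ.≤-trans (ℕ.m≤m*n 2 (5 ℕ.+ (m ℕ.+ m))) 4m+10≤a))

  1≤w : 1ℚ ℚ.≤ w
  1≤w = ℚ.≤-trans (from-yes (1ℚ ℚ.≤? ℤ→ℚ (+ 2))) 2≤w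

  u≤1 : u ℚ.≤ 1ℚ
  u≤1 = subst₂ ℚ._≤_ (ℚ.*-identityˡ u) w*u≡1 (*-monoʳ u 0≤u 1≤w)

  w^*u^≡1 : ∀ k → w ^ℚ k ℚ.* u ^ℚ k ≡ 1ℚ
  w^*u^≡1 k = trans (sym (^-distrib-* w u k)) (trans (cong (_^ℚ k) w*u≡1) (1^≡1 k))
    where
    1^≡1 : ∀ k → 1ℚ ^ℚ k ≡ 1ℚ
    1^≡1 zero    = refl
    1^≡1 (suc k) = trans (ℚ.*-identityˡ (1ℚ ^ℚ k)) (1^≡1 k)

  -- `K` is the degree d and `u` is 1 / a. The parameter `s` allows one treatment of both maps.
  iteration : ℚ → ℚ → ℚ
  iteration s x = (w ℚ.- x ℚ.* x ℚ.+ s ℚ.* x ^ℚ K) ℚ.* u ^ℚ n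

  square≤1 : ∀ {x} → Unit x → x ℚ.* x ℚ.≤ 1ℚ
  square≤1 {x} (0≤x , x≤1) = *-mono-≤ 0≤1 0≤x x≤1 x≤1

  1≤w-x² : ∀ {x} → Unit x → 1ℚ ℚ.≤ w ℚ.- x ℚ.* x
  1≤w-x² {x} x∈ = ℚ.+-mono-≤ {ℤ→ℚ (+ 2)} {w} {ℚ.- 1ℚ} {ℚ.- (x ℚ.* x)} 2≤w
    (ℚ.neg-antimono-≤ (square≤1 x∈))

  -- The values have order `u ^ℚ m`. The weaker bound comes from w - x² ≥ 1 alone and is enough to
  -- keep the orbits away from 0 after the first step.
  iteration-lower : ∀ {s x} → Unit s → Unit x → u ^ℚ n ℚ.≤ iteration s x
  iteration-lower {s} {x} (0≤s , _) x∈ = subst (ℚ._≤ iteration s x) (ℚ.*-identityˡ (u ^ℚ n))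
    (*-monoʳ (u ^ℚ n) (0≤^ n 0≤u) (ℚ.≤-trans (1≤w-x² x∈)
      (x≤x+y (0≤* 0≤s (0≤^ K (proj₁ x∈))))))

  -- As xᴷ ≤ x² on the unit interval, s xᴷ is absorbed by -x², and w uⁿ = uᵐ is left.
  iteration-upper : ∀ {s x} → Unit s → Unit x → iteration s x ℚ.≤ u ^ℚ m
  iteration-upper {s} {x} (0≤s , s≤1) x∈@(0≤x , _) = begin
    (w ℚ.- x ℚ.* x ℚ.+ s ℚ.* x ^ℚ K) ℚ.* u ^ℚ n
      ≤⟨ *-monoʳ (u ^ℚ n) (0≤^ n 0≤u) (ℚ.+-monoʳ-≤ (w ℚ.- x ℚ.* x)
           (*-mono-≤ 0≤1 (0≤^ K 0≤x) s≤1
             (*-monoˡ x 0≤x (*-monoˡ x 0≤x (proj₂ (unit-^ (suc (m ℕ.+ m)) x∈)))))) ⟩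
    (w ℚ.- x ℚ.* x ℚ.+ 1ℚ ℚ.* (x ℚ.* (x ℚ.* 1ℚ))) ℚ.* (u ℚ.* u ^ℚ m)
      ≡⟨ solveℚ 4 (λ w x u U → (w :- x :* x :+ con 1ℚ :* (x :* (x :* con 1ℚ))) :* (u :* U) :=
           (w :* u) :* U) refl w x u (u ^ℚ m) ⟩
    (w ℚ.* u) ℚ.* u ^ℚ m
      ≡⟨ cong (ℚ._* u ^ℚ m) w*u≡1 ⟩
    1ℚ ℚ.* u ^ℚ m
      ≡⟨ ℚ.*-identityˡ (u ^ℚ m) ⟩
    u ^ℚ m ∎
    where open ℚ.≤-Reasoning

  iteration-unit : ∀ {s x} → Unit s → Unit x → Unit (iteration s x)
  iteration-unit s∈ x∈ = ℚ.≤-trans (0≤^ n 0≤u) (iteration-lower s∈ x∈) ,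
    ℚ.≤-trans (iteration-upper s∈ x∈) (^-≤1 m 0≤u u≤1)

  -- `K` and 2 are the Lipschitz constants of xᴷ and x² on the unit interval; the hypothesis 2 (K +
  -- 2) ≤ a is made for this estimate.
  lipschitz≤½ : ℤ→ℚ (+ (K ℕ.+ 2)) ℚ.* u ^ℚ n ℚ.≤ ½
  lipschitz≤½ = begin
    c ℚ.* (u ℚ.* u ^ℚ m)
      ≤⟨ *-monoˡ c 0≤c (*-monoˡ u 0≤u (^-≤1 m 0≤u u≤1)) ⟩
    c ℚ.* (u ℚ.* 1ℚ)
      ≡⟨ solveℚ 2 (λ c u → c :* (u :* con 1ℚ) := con ½ :* ((con (ℤ→ℚ (+ 2)) :* c) :* u)) refl c u ⟩
    ½ ℚ.* ((ℤ→ℚ (+ 2) ℚ.* c) ℚ.* u)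
      ≤⟨ *-monoˡ ½ 0≤½ (*-monoʳ u 0≤u 2c≤w) ⟩
    ½ ℚ.* (w ℚ.* u)
      ≡⟨ cong (½ ℚ.*_) w*u≡1 ⟩
    ½ ∎
    where
    open ℚ.≤-Reasoning
    c = ℤ→ℚ (+ (K ℕ.+ 2))
    0≤c : 0ℚ ℚ.≤ c
    0≤c = 0≤ℤ→ℚ (K ℕ.+ 2)
    2c≤w : ℤ→ℚ (+ 2) ℚ.* c ℚ.≤ w
    2c≤w = subst (ℚ._≤ w)
      (trans (cong ℤ→ℚ (ℤ.pos-* 2 (K ℕ.+ 2))) (ℤ→ℚ-homo-* (+ 2) (+ (K ℕ.+ 2))))
      (ℤ→ℚ-mono-≤ (ℤ.+≤+ (subst (λ k → 2 ℕ.* k ℕ.≤ a) (ℕ.+-comm 2 K) 4m+10≤a)))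

  iteration-contracts : ∀ {s x y} → Unit s → Unit x → Unit y →
    ℚ.∣ iteration s x ℚ.- iteration s y ∣ ℚ.≤ ½ ℚ.* ℚ.∣ x ℚ.- y ∣
  iteration-contracts {s} {x} {y} s∈ x∈ y∈ = begin
    ℚ.∣ iteration s x ℚ.- iteration s y ∣
      ≡⟨ cong ℚ.∣_∣ (solveℚ 7 (λ w s x y X Y U →
           (w :- x :* x :+ s :* X) :* U :- (w :- y :* y :+ s :* Y) :* U :=
           (s :* (X :- Y) :- (x :* (x :* con 1ℚ) :- y :* (y :* con 1ℚ))) :* U)
           refl w s x y (x ^ℚ K) (y ^ℚ K) (u ^ℚ n)) ⟩
    ℚ.∣ (p ℚ.- q) ℚ.* u ^ℚ n ∣
      ≡⟨ ℚ.∣p*q∣≡∣p∣*∣q∣ (p ℚ.- q) (u ^ℚ n) ⟩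
    ℚ.∣ p ℚ.- q ∣ ℚ.* ℚ.∣ u ^ℚ n ∣
      ≡⟨ cong (ℚ.∣ p ℚ.- q ∣ ℚ.*_) (ℚ.0≤p⇒∣p∣≡p (0≤^ n 0≤u)) ⟩
    ℚ.∣ p ℚ.- q ∣ ℚ.* u ^ℚ n
      ≤⟨ *-monoʳ (u ^ℚ n) (0≤^ n 0≤u) (ℚ.≤-trans (ℚ.∣p-q∣≤∣p∣+∣q∣ p q) (ℚ.+-mono-≤
           (CauchyLemmas.*-mono-≤-∣∣ s (x ^ℚ K ℚ.- y ^ℚ K) 0≤1 (unit-∣-∣ s∈) (^-lipschitz K x∈ y∈))
           (^-lipschitz 2 x∈ y∈))) ⟩
    (1ℚ ℚ.* (ℤ→ℚ (+ K) ℚ.* δ) ℚ.+ ℤ→ℚ (+ 2) ℚ.* δ) ℚ.* u ^ℚ n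
      ≡⟨ solveℚ 4 (λ K t δ U → (con 1ℚ :* (K :* δ) :+ t :* δ) :* U := ((K :+ t) :* U) :* δ)
           refl (ℤ→ℚ (+ K)) (ℤ→ℚ (+ 2)) δ (u ^ℚ n) ⟩
    ((ℤ→ℚ (+ K) ℚ.+ ℤ→ℚ (+ 2)) ℚ.* u ^ℚ n) ℚ.* δ
      ≡⟨ cong (λ c → (c ℚ.* u ^ℚ n) ℚ.* δ) (ℤ→ℚ-homo-+ (+ K) (+ 2)) ⟨
    (ℤ→ℚ (+ (K ℕ.+ 2)) ℚ.* u ^ℚ n) ℚ.* δ
      ≤⟨ *-monoʳ δ (ℚ.0≤∣p∣ (x ℚ.- y)) lipschitz≤½ ⟩
    ½ ℚ.* δ ∎
    where
    open ℚ.≤-Reasoning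
    δ = ℚ.∣ x ℚ.- y ∣
    p = s ℚ.* (x ^ℚ K ℚ.- y ^ℚ K)
    q = x ^ℚ 2 ℚ.- y ^ℚ 2

  evalA evalB : ℚ → ℚ
  evalA = evalℚ (factorA a m)
  evalB = evalℚ (factorB a m)

  evalB-expand : ∀ x → evalB x ≡ x ℚ.* x ℚ.+ w ^ℚ n ℚ.* x ℚ.- w
  evalB-expand x = begin
    ℤ→ℚ (ℤ.- + a) ℚ.+ x ℚ.* (ℤ→ℚ (+ (a ℕ.^ n)) ℚ.+ x ℚ.* (1ℚ ℚ.+ x ℚ.* 0ℚ))
      ≡⟨ cong₂ (λ s t → s ℚ.+ x ℚ.* (t ℚ.+ x ℚ.* (1ℚ ℚ.+ x ℚ.* 0ℚ)))
           (ℤ→ℚ-homo-neg (+ a)) (ℤ→ℚ-homo-^ a n) ⟩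
    ℚ.- w ℚ.+ x ℚ.* (w ^ℚ n ℚ.+ x ℚ.* (1ℚ ℚ.+ x ℚ.* 0ℚ))
      ≡⟨ solveℚ 3 (λ w x W → :- w :+ x :* (W :+ x :* (con 1ℚ :+ x :* con 0ℚ)) :=
           x :* x :+ W :* x :- w) refl w x (w ^ℚ n) ⟩
    x ℚ.* x ℚ.+ w ^ℚ n ℚ.* x ℚ.- w ∎
    where open ≡-Reasoning

  evalA-evalB : ∀ x → (w ℚ.- x ℚ.* x) ℚ.* evalA x ≡ evalB x ℚ.- x ^ℚ K
  evalA-evalB x = begin
    (w ℚ.- x ℚ.* x) ℚ.* (ℚ.- 1ℚ ℚ.+ x ℚ.* p)
      ≡⟨ solveℚ 3 (λ w x p → (w :- x :* x) :* (:- con 1ℚ :+ x :* p) :=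
           x :* x :- w :- x :* ((x :* x :- w) :* p)) refl w x p ⟩
    x ℚ.* x ℚ.- w ℚ.- x ℚ.* ((x ℚ.* x ℚ.- w) ℚ.* p)
      ≡⟨ cong (λ c → x ℚ.* x ℚ.- w ℚ.- x ℚ.* c) (evalℚ-geometric a m x) ⟩
    x ℚ.* x ℚ.- w ℚ.- x ℚ.* (x ℚ.* x ℚ.* (x ℚ.* x) ^ℚ m ℚ.- w ^ℚ n)
      ≡⟨ cong (λ c → x ℚ.* x ℚ.- w ℚ.- x ℚ.* (x ℚ.* x ℚ.* c ℚ.- w ^ℚ n))
           (trans (^-distrib-* x x m) (sym (^-homo-* x m m))) ⟩
    x ℚ.* x ℚ.- w ℚ.- x ℚ.* (x ℚ.* x ℚ.* x ^ℚ (m ℕ.+ m) ℚ.- w ^ℚ n)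
      ≡⟨ solveℚ 4 (λ w x X W → x :* x :- w :- x :* (x :* x :* X :- W) :=
           x :* x :+ W :* x :- w :- x :* (x :* (x :* X))) refl w x (x ^ℚ (m ℕ.+ m)) (w ^ℚ n) ⟩
    x ℚ.* x ℚ.+ w ^ℚ n ℚ.* x ℚ.- w ℚ.- x ^ℚ K
      ≡⟨ cong (ℚ._- x ^ℚ K) (evalB-expand x) ⟨
    evalB x ℚ.- x ^ℚ K ∎
    where
    open ≡-Reasoning
    p = evalℚ (geometric a m) x

  -- Multiplied by aⁿ, the fixed-point defect becomes a polynomial value: -B for s = 0 and xᴷ - B
  -- for s = 1.
  iteration-residual : ∀ s x → s ℚ.* x ^ℚ K ℚ.- evalB x ≡ w ^ℚ n ℚ.* (iteration s x ℚ.- x)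
  iteration-residual s x = begin
    s ℚ.* x ^ℚ K ℚ.- evalB x
      ≡⟨ cong (λ b → s ℚ.* x ^ℚ K ℚ.- b) (evalB-expand x) ⟩
    s ℚ.* x ^ℚ K ℚ.- (x ℚ.* x ℚ.+ w ^ℚ n ℚ.* x ℚ.- w)
      ≡⟨ solveℚ 5 (λ s X x W w → s :* X :- (x :* x :+ W :* x :- w) :=
           (w :- x :* x :+ s :* X) :* con 1ℚ :- W :* x) refl s (x ^ℚ K) x (w ^ℚ n) w ⟩
    (w ℚ.- x ℚ.* x ℚ.+ s ℚ.* x ^ℚ K) ℚ.* 1ℚ ℚ.- w ^ℚ n ℚ.* x
      ≡⟨ cong (λ c → (w ℚ.- x ℚ.* x ℚ.+ s ℚ.* x ^ℚ K) ℚ.* c ℚ.- w ^ℚ n ℚ.* x) (w^*u^≡1 n) ⟨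
    (w ℚ.- x ℚ.* x ℚ.+ s ℚ.* x ^ℚ K) ℚ.* (w ^ℚ n ℚ.* u ^ℚ n) ℚ.- w ^ℚ n ℚ.* x
      ≡⟨ solveℚ 4 (λ F W U x → F :* (W :* U) :- W :* x := W :* (F :* U :- x))
           refl (w ℚ.- x ℚ.* x ℚ.+ s ℚ.* x ^ℚ K) (w ^ℚ n) (u ^ℚ n) x ⟩
    w ^ℚ n ℚ.* (iteration s x ℚ.- x) ∎
    where open ≡-Reasoning

  -- The divisor w - x² is at least 1 on the unit interval, so dividing by it cannot increase the
  -- absolute value.
  ∣evalA∣≤ : ∀ {x} → Unit x → ℚ.∣ evalA x ∣ ℚ.≤ ℚ.∣ evalB x ℚ.- x ^ℚ K ∣
  ∣evalA∣≤ {x} x∈ = begin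
    ℚ.∣ evalA x ∣
      ≡⟨ ℚ.*-identityˡ ℚ.∣ evalA x ∣ ⟨
    1ℚ ℚ.* ℚ.∣ evalA x ∣
      ≤⟨ *-monoʳ ℚ.∣ evalA x ∣ (ℚ.0≤∣p∣ (evalA x)) (1≤w-x² x∈) ⟩
    (w ℚ.- x ℚ.* x) ℚ.* ℚ.∣ evalA x ∣
      ≡⟨ cong (ℚ._* ℚ.∣ evalA x ∣) (ℚ.0≤p⇒∣p∣≡p (ℚ.≤-trans 0≤1 (1≤w-x² x∈))) ⟨
    ℚ.∣ w ℚ.- x ℚ.* x ∣ ℚ.* ℚ.∣ evalA x ∣
      ≡⟨ ℚ.∣p*q∣≡∣p∣*∣q∣ (w ℚ.- x ℚ.* x) (evalA x) ⟨
    ℚ.∣ (w ℚ.- x ℚ.* x) ℚ.* evalA x ∣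
      ≡⟨ cong ℚ.∣_∣ (evalA-evalB x) ⟩
    ℚ.∣ evalB x ℚ.- x ^ℚ K ∣ ∎
    where open ℚ.≤-Reasoning

  -- B and B − xᴷ differ by at most 1 on the unit interval and ∣ A ∣ ≤ ∣ B − xᴷ ∣,
  -- so it suffices that one of the two is small.
  ∣family∣≤ : ∀ {x η} → Unit x → η ℚ.≤ w ^ℚ n →
    ℚ.∣ evalB x ∣ ℚ.≤ η ⊎ ℚ.∣ evalB x ℚ.- x ^ℚ K ∣ ℚ.≤ η →
    ℚ.∣ evalℚ (family a m) x ∣ ℚ.≤ (w ^ℚ n ℚ.+ 1ℚ) ℚ.* η
  ∣family∣≤ {x} {η} x∈ η≤W small = begin
    ℚ.∣ evalℚ (family a m) x ∣
      ≡⟨ cong ℚ.∣_∣ (evalℚ-mul (factorB a m) (factorA a m) x) ⟩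
    ℚ.∣ evalB x ℚ.* evalA x ∣
      ≡⟨ ℚ.∣p*q∣≡∣p∣*∣q∣ (evalB x) (evalA x) ⟩
    b ℚ.* ℚ.∣ evalA x ∣
      ≤⟨ *-monoˡ b (ℚ.0≤∣p∣ (evalB x)) (∣evalA∣≤ x∈) ⟩
    b ℚ.* c
      ≤⟨ bounded small ⟩
    (w ^ℚ n ℚ.+ 1ℚ) ℚ.* η ∎
    where
    open ℚ.≤-Reasoning
    b c : ℚ
    b = ℚ.∣ evalB x ∣
    c = ℚ.∣ evalB x ℚ.- x ^ℚ K ∣
    0≤b : 0ℚ ℚ.≤ b
    0≤b = ℚ.0≤∣p∣ (evalB x)
    0≤c : 0ℚ ℚ.≤ c
    0≤c = ℚ.0≤∣p∣ (evalB x ℚ.- x ^ℚ K)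
    ∣x^K∣≤1 : ℚ.∣ x ^ℚ K ∣ ℚ.≤ 1ℚ
    ∣x^K∣≤1 = unit-∣-∣ (unit-^ K x∈)
    0≤W+1 : 0ℚ ℚ.≤ w ^ℚ n ℚ.+ 1ℚ
    0≤W+1 = ℚ.≤-trans (0≤^ n 0≤w) (x≤x+y {w ^ℚ n} {1ℚ} 0≤1)
    b≤c+1 : b ℚ.≤ c ℚ.+ 1ℚ
    b≤c+1 = begin
      b ≡⟨ cong ℚ.∣_∣ (CauchyLemmas.diff-+ (evalB x) (x ^ℚ K)) ⟨
      ℚ.∣ evalB x ℚ.- x ^ℚ K ℚ.+ x ^ℚ K ∣ ≤⟨ ℚ.∣p+q∣≤∣p∣+∣q∣ (evalB x ℚ.- x ^ℚ K) (x ^ℚ K) ⟩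
      c ℚ.+ ℚ.∣ x ^ℚ K ∣ ≤⟨ ℚ.+-monoʳ-≤ c ∣x^K∣≤1 ⟩
      c ℚ.+ 1ℚ ∎
    c≤b+1 : c ℚ.≤ b ℚ.+ 1ℚ
    c≤b+1 = ℚ.≤-trans (ℚ.∣p-q∣≤∣p∣+∣q∣ (evalB x) (x ^ℚ K)) (ℚ.+-monoʳ-≤ b ∣x^K∣≤1)
    bounded : b ℚ.≤ η ⊎ c ℚ.≤ η → b ℚ.* c ℚ.≤ (w ^ℚ n ℚ.+ 1ℚ) ℚ.* η
    bounded (inj₁ b≤η) = subst (ℚ._≤ (w ^ℚ n ℚ.+ 1ℚ) ℚ.* η) (ℚ.*-comm c b)
      (*-mono-≤ 0≤W+1 0≤b
        (ℚ.≤-trans c≤b+1 (ℚ.+-monoˡ-≤ 1ℚ (ℚ.≤-trans b≤η η≤W))) b≤η)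
    bounded (inj₂ c≤η) = *-mono-≤ 0≤W+1 0≤c
      (ℚ.≤-trans b≤c+1 (ℚ.+-monoˡ-≤ 1ℚ (ℚ.≤-trans c≤η η≤W))) c≤η

  module Orbit {s : ℚ} (s∈ : Unit s) = Contraction (iteration s)
    (λ {x} → iteration-unit {s} {x} s∈) (λ {x} {y} → iteration-contracts {s} {x} {y} s∈)

  orbit-residual : ∀ {s} (s∈ : Unit s) k →
    let x = Orbit.orbit s∈ k in ℚ.∣ s ℚ.* x ^ℚ K ℚ.- evalB x ∣ ℚ.≤ w ^ℚ n ℚ.* ½ ^ℚ k
  orbit-residual {s} s∈ k = begin
    ℚ.∣ s ℚ.* x ^ℚ K ℚ.- evalB x ∣
      ≡⟨ cong ℚ.∣_∣ (iteration-residual s x) ⟩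
    ℚ.∣ w ^ℚ n ℚ.* (iteration s x ℚ.- x) ∣
      ≤⟨ CauchyLemmas.*-mono-≤-∣∣ (w ^ℚ n) (iteration s x ℚ.- x) (0≤^ n 0≤w)
           (ℚ.≤-reflexive (ℚ.0≤p⇒∣p∣≡p (0≤^ n 0≤w))) (Orbit.residual s∈ k) ⟩
    w ^ℚ n ℚ.* ½ ^ℚ k ∎
    where
    open ℚ.≤-Reasoning
    x = Orbit.orbit s∈ k

  orbit-root : ∀ {s} (s∈ : Unit s) →
    (∀ k → let x = Orbit.orbit s∈ k ; η = w ^ℚ n ℚ.* ½ ^ℚ k in
      ℚ.∣ evalB x ∣ ℚ.≤ η ⊎ ℚ.∣ evalB x ℚ.- x ^ℚ K ∣ ℚ.≤ η) →
    IsRoot (family a m) (ℝ→ℂ (Orbit.fixedPoint s∈))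
  orbit-root {s} s∈ small = realRoot (family a m) (Orbit.fixedPoint s∈) λ ε 0<ε →
    proj₁ (½^-vanishes C 0<C ε 0<ε) , λ k N≤k → begin
      ℚ.∣ evalℚ (family a m) (Orbit.orbit s∈ k) ∣
        ≤⟨ ∣family∣≤ (Orbit.orbit-unit s∈ k) (η≤W k) (small k) ⟩
      (W ℚ.+ 1ℚ) ℚ.* (W ℚ.* ½ ^ℚ k)
        ≡⟨ ℚ.*-assoc (W ℚ.+ 1ℚ) W (½ ^ℚ k) ⟨
      C ℚ.* ½ ^ℚ k
        ≤⟨ proj₂ (½^-vanishes C 0<C ε 0<ε) k N≤k ⟩
      ε ∎
    where
    open ℚ.≤-Reasoning
    W C : ℚ
    W = w ^ℚ n
    -- The factor `W ℚ.+ 1ℚ` comes from `∣family∣≤`, the factor `W` from the residual of the orbit.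
    C = (W ℚ.+ 1ℚ) ℚ.* W
    0<W : 0ℚ ℚ.< W
    0<W = 0<^ n (ℚ.<-≤-trans (ℚ.positive⁻¹ 1ℚ) 1≤w)
    0<C : 0ℚ ℚ.< C
    0<C = 0<* (ℚ.+-mono-< 0<W (ℚ.positive⁻¹ 1ℚ)) 0<W
    η≤W : ∀ k → W ℚ.* ½ ^ℚ k ℚ.≤ W
    η≤W k = subst (W ℚ.* ½ ^ℚ k ℚ.≤_) (ℚ.*-identityʳ W)
      (*-monoˡ W (0≤^ n 0≤w) (^-≤1 k 0≤½ (from-yes (½ ℚ.≤? 1ℚ))))

  0∈ : Unit 0ℚ
  0∈ = ℚ.≤-refl , 0≤1

  1∈ : Unit 1ℚ
  1∈ = 0≤1 , ℚ.≤-refl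

  open Orbit 1∈ using () renaming (orbit to x; orbit-unit to x-unit; fixedPoint to α) public
  open Orbit 0∈ using () renaming (orbit to y; orbit-unit to y-unit; fixedPoint to β) public

  α-root : IsRoot (family a m) (ℝ→ℂ α)
  α-root = orbit-root 1∈ λ k → inj₂ (subst (ℚ._≤ w ^ℚ n ℚ.* ½ ^ℚ k)
    (trans (sym (ℚ.∣-p∣≡∣p∣ (1ℚ ℚ.* x k ^ℚ K ℚ.- evalB (x k)))) (cong ℚ.∣_∣
      (solveℚ 2 (λ X b → :- (con 1ℚ :* X :- b) := b :- X) refl (x k ^ℚ K) (evalB (x k)))))
    (orbit-residual 1∈ k))

  β-root : IsRoot (family a m) (ℝ→ℂ β)
  β-root = orbit-root 0∈ λ k → inj₁ (subst (ℚ._≤ w ^ℚ n ℚ.* ½ ^ℚ k)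
    (trans (sym (ℚ.∣-p∣≡∣p∣ (0ℚ ℚ.* y k ^ℚ K ℚ.- evalB (y k)))) (cong ℚ.∣_∣
      (solveℚ 2 (λ X b → :- (con 0ℚ :* X :- b) := b) refl (y k ^ℚ K) (evalB (y k)))))
    (orbit-residual 0∈ k))

  x-upper : ∀ k → x k ℚ.≤ u ^ℚ m
  x-upper zero    = 0≤^ m 0≤u
  x-upper (suc k) = iteration-upper 1∈ (x-unit k)

  -- At the same point the two maps differ by exactly uⁿ xᴷ, so both orbits can be compared through
  -- the single map with s = 0 and this added term.
  orbit-difference : ∀ k → x (suc k) ℚ.- y (suc k) ≡
    (iteration 0ℚ (x k) ℚ.- iteration 0ℚ (y k)) ℚ.+ u ^ℚ n ℚ.* x k ^ℚ K
  orbit-difference k = solveℚ 6 (λ w x y U X Y →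
      (w :- x :* x :+ con 1ℚ :* X) :* U :- (w :- y :* y :+ con 0ℚ :* Y) :* U :=
      ((w :- x :* x :+ con 0ℚ :* X) :* U :- (w :- y :* y :+ con 0ℚ :* Y) :* U) :+ U :* X)
    refl w (x k) (y k) (u ^ℚ n) (x k ^ℚ K) (y k ^ℚ K)

  -- The largest possible added term uⁿ xᴷ, by `x-upper`. Collecting exponents gives a to the power
  -- -E.
  ρ : ℚ
  ρ = u ^ℚ n ℚ.* (u ^ℚ m) ^ℚ K

  0<ρ : 0ℚ ℚ.< ρ
  0<ρ = 0<* (0<^ n 0<u) (0<^ K (0<^ m 0<u))

  -- The bound 2ρ is the fixed point of t ↦ t / 2 + ρ, hence preserved by each step.
  orbit-distance : ∀ k → ℚ.∣ x k ℚ.- y k ∣ ℚ.≤ ρ ℚ.+ ρ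
  orbit-distance zero    = ℚ.≤-trans (ℚ.<⇒≤ 0<ρ) (x≤x+y {ρ} {ρ} (ℚ.<⇒≤ 0<ρ))
  orbit-distance (suc k) = begin
    ℚ.∣ x (suc k) ℚ.- y (suc k) ∣
      ≡⟨ cong ℚ.∣_∣ (orbit-difference k) ⟩
    ℚ.∣ δ ℚ.+ t ∣
      ≤⟨ ℚ.∣p+q∣≤∣p∣+∣q∣ δ t ⟩
    ℚ.∣ δ ∣ ℚ.+ ℚ.∣ t ∣
      ≡⟨ cong (ℚ.∣ δ ∣ ℚ.+_) (ℚ.0≤p⇒∣p∣≡p (0≤* (0≤^ n 0≤u) (0≤^ K 0≤x))) ⟩
    ℚ.∣ δ ∣ ℚ.+ t
      ≤⟨ ℚ.+-mono-≤ (iteration-contracts 0∈ (x-unit k) (y-unit k))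
           (*-monoˡ (u ^ℚ n) (0≤^ n 0≤u) (^-monoˡ-≤ K 0≤x (x-upper k))) ⟩
    ½ ℚ.* ℚ.∣ x k ℚ.- y k ∣ ℚ.+ ρ
      ≤⟨ ℚ.+-monoˡ-≤ ρ (*-monoˡ ½ 0≤½ (orbit-distance k)) ⟩
    ½ ℚ.* (ρ ℚ.+ ρ) ℚ.+ ρ
      ≡⟨ cong (ℚ._+ ρ) (trans (ℚ.*-distribˡ-+ ½ ρ ρ) (CauchyLemmas.half+half ρ)) ⟩
    ρ ℚ.+ ρ ∎
    where
    open ℚ.≤-Reasoning
    δ t : ℚ
    δ = iteration 0ℚ (x k) ℚ.- iteration 0ℚ (y k)
    t = u ^ℚ n ℚ.* x k ^ℚ K
    0≤x : 0ℚ ℚ.≤ x k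
    0≤x = proj₁ (x-unit k)

  -- Here `c` bounds the added term from below. Were the limits equal, the distances would
  -- eventually be at most ε = c / 2, and the recursion would give c ≤ ε + ε / 2 = 3c / 4.
  α≉β : ¬ (ℝ→ℂ α ≈ℂ ℝ→ℂ β)
  α≉β (α≈β , _) = ℚ.<-irrefl refl (ℚ.<-≤-trans c<c′ c≤)
    where
    open ℚ.≤-Reasoning
    c ε : ℚ
    c = u ^ℚ n ℚ.* (u ^ℚ n) ^ℚ K
    ε = ½ ℚ.* c
    0<c : 0ℚ ℚ.< c
    0<c = 0<* (0<^ n 0<u) (0<^ K (0<^ n 0<u))
    0<ε : 0ℚ ℚ.< ε
    0<ε = CauchyLemmas.half-pos c 0<c
    N : ℕ
    N = proj₁ (α≈β ε 0<ε)
    close : ∀ k → N ℕ.≤ k → ℚ.∣ x k ℚ.- y k ∣ ℚ.≤ ε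
    close = proj₂ (α≈β ε 0<ε)
    -- The orbit starts at 0, so the lower bound on `x k` needs an index that is a successor.
    k : ℕ
    k = suc N
    δ t : ℚ
    δ = iteration 0ℚ (x k) ℚ.- iteration 0ℚ (y k)
    t = u ^ℚ n ℚ.* x k ^ℚ K
    c≤ : c ℚ.≤ ε ℚ.+ ½ ℚ.* ε
    c≤ = begin
      c
        ≤⟨ *-monoˡ (u ^ℚ n) (0≤^ n 0≤u) (^-monoˡ-≤ K (0≤^ n 0≤u) (iteration-lower 1∈ (x-unit N))) ⟩
      t
        ≡⟨ ℚ.0≤p⇒∣p∣≡p (0≤* (0≤^ n 0≤u) (0≤^ K (proj₁ (x-unit k)))) ⟨
      ℚ.∣ t ∣
        ≡⟨ cong ℚ.∣_∣ (trans (solveℚ 2 (λ δ t → t := (δ :+ t) :- δ) refl δ t)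
             (cong (ℚ._- δ) (sym (orbit-difference k)))) ⟩
      ℚ.∣ (x (suc k) ℚ.- y (suc k)) ℚ.- δ ∣
        ≤⟨ ℚ.∣p-q∣≤∣p∣+∣q∣ (x (suc k) ℚ.- y (suc k)) δ ⟩
      ℚ.∣ x (suc k) ℚ.- y (suc k) ∣ ℚ.+ ℚ.∣ δ ∣
        ≤⟨ ℚ.+-mono-≤ (close (suc k) (ℕ.m≤n⇒m≤1+n (ℕ.n≤1+n N)))
             (ℚ.≤-trans (iteration-contracts 0∈ (x-unit k) (y-unit k))
               (*-monoˡ ½ 0≤½ (close k (ℕ.n≤1+n N)))) ⟩
      ε ℚ.+ ½ ℚ.* ε ∎
    c<c′ : ε ℚ.+ ½ ℚ.* ε ℚ.< c
    c<c′ = subst (ε ℚ.+ ½ ℚ.* ε ℚ.<_) (CauchyLemmas.half+half c)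
      (ℚ.+-monoʳ-< ε (subst (½ ℚ.* ε ℚ.<_) (ℚ.*-identityˡ ε)
        (ℚ.*-monoˡ-<-pos ε {{positive 0<ε}} (from-yes (½ ℚ.<? 1ℚ)))))

  -- Strict inequality of reals asks for a rational gap. Passing from 2ρ to 3ρ leaves 9ρ² - 4ρ² =
  -- 5ρ² between the squares.
  distance<3ρ : ∣ ℝ→ℂ α +ℂ -ℂ ℝ→ℂ β ∣< (ℤ→ℚ (+ 3) ℚ.* ρ)
  distance<3ρ = 0<* (from-yes (0ℚ ℚ.<? ℤ→ℚ (+ 3))) 0<ρ ,
    ℤ→ℚ (+ 5) ℚ.* (ρ ℚ.* ρ) , 0<* (from-yes (0ℚ ℚ.<? ℤ→ℚ (+ 5))) (0<* 0<ρ 0<ρ) , 0 , λ k _ → begin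
      (x k ℚ.- y k) ℚ.* (x k ℚ.- y k) ℚ.+ 0ℚ ℚ.+ ℤ→ℚ (+ 5) ℚ.* (ρ ℚ.* ρ)
        ≤⟨ ℚ.+-monoˡ-≤ (ℤ→ℚ (+ 5) ℚ.* (ρ ℚ.* ρ)) (ℚ.+-monoˡ-≤ 0ℚ (square-distance k)) ⟩
      (ρ ℚ.+ ρ) ℚ.* (ρ ℚ.+ ρ) ℚ.+ 0ℚ ℚ.+ ℤ→ℚ (+ 5) ℚ.* (ρ ℚ.* ρ)
        ≡⟨ solveℚ 1 (λ ρ → (ρ :+ ρ) :* (ρ :+ ρ) :+ con 0ℚ :+ con (ℤ→ℚ (+ 5)) :* (ρ :* ρ) :=
             (con (ℤ→ℚ (+ 3)) :* ρ) :* (con (ℤ→ℚ (+ 3)) :* ρ)) refl ρ ⟩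
      (ℤ→ℚ (+ 3) ℚ.* ρ) ℚ.* (ℤ→ℚ (+ 3) ℚ.* ρ) ∎
    where
    open ℚ.≤-Reasoning
    square-distance : ∀ k → (x k ℚ.- y k) ℚ.* (x k ℚ.- y k) ℚ.≤ (ρ ℚ.+ ρ) ℚ.* (ρ ℚ.+ ρ)
    square-distance k = ℚ.≤-trans (p≤∣p∣ (d ℚ.* d))
      (CauchyLemmas.*-mono-≤-∣∣ d d (ℚ.≤-trans (ℚ.0≤∣p∣ d) (orbit-distance k))
        (orbit-distance k) (orbit-distance k))
      where
      d = x k ℚ.- y k
      p≤∣p∣ : ∀ p → p ℚ.≤ ℚ.∣ p ∣
      p≤∣p∣ p with ℚ.≤-total 0ℚ p
      ... | inj₁ 0≤p = ℚ.≤-reflexive (sym (ℚ.0≤p⇒∣p∣≡p 0≤p))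
      ... | inj₂ p≤0 = ℚ.≤-trans p≤0 (ℚ.0≤∣p∣ p)

-- Exponents

k*[i/k]≡i : ∀ i k .{{_ : ℕ.NonZero k}} → ℤ→ℚ (+ k) ℚ.* (i / k) ≡ ℤ→ℚ i
k*[i/k]≡i i k@(suc k-1) = ℚ.toℚᵘ-injective (begin
  ℚ.toℚᵘ (ℤ→ℚ (+ k) ℚ.* (i / k))            ≈⟨ ℚ.toℚᵘ-homo-* (ℤ→ℚ (+ k)) (i / k) ⟩
  ℚ.toℚᵘ (ℤ→ℚ (+ k)) ℚᵘ.* ℚ.toℚᵘ (i / k)    ≈⟨ ℚᵘ.*-cong (toℚᵘ-ℤ→ℚ (+ k)) (ℚ.toℚᵘ-fromℚᵘ (mkℚᵘ i k-1)) ⟩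
  mkℚᵘ (+ k) 0 ℚᵘ.* mkℚᵘ i k-1              ≈⟨ *≡* cross ⟩
  mkℚᵘ i 0                                  ≈⟨ toℚᵘ-ℤ→ℚ i ⟨
  ℚ.toℚᵘ (ℤ→ℚ i)                            ∎)
  where
  open ℚᵘ.≃-Reasoning
  cross : + k ℤ.* i ℤ.* + 1 ≡ i ℤ.* + suc (k-1 ℕ.+ 0)
  cross = trans (ℤ.*-identityʳ (+ k ℤ.* i)) (trans (ℤ.*-comm (+ k) i)
    (cong (λ j → i ℤ.* + suc j) (sym (ℕ.+-identityʳ k-1))))

ℤ→ℚ-cancel-< : ∀ {i j} → ℤ→ℚ i ℚ.< ℤ→ℚ j → i ℤ.< j
ℤ→ℚ-cancel-< {i} {j} i<j = ℤ.≰⇒> λ j≤i → ℚ.<-irrefl refl (ℚ.<-≤-trans i<j (ℤ→ℚ-mono-≤ {j} {i} j≤i))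

ℤ→ℚ-pos-* : ∀ j k → ℤ→ℚ (+ (j ℕ.* k)) ≡ ℤ→ℚ (+ j) ℚ.* ℤ→ℚ (+ k)
ℤ→ℚ-pos-* j k = trans (cong ℤ→ℚ (ℤ.pos-* j k)) (ℤ→ℚ-homo-* (+ j) (+ k))

ℕ-^-distribʳ-* : ∀ n i j → (i ℕ.* j) ℕ.^ n ≡ i ℕ.^ n ℕ.* j ℕ.^ n
ℕ-^-distribʳ-* zero    i j = refl
ℕ-^-distribʳ-* (suc n) i j = trans (cong (i ℕ.* j ℕ.*_) (ℕ-^-distribʳ-* n i j))
  (ℕ.[m*n]*[o*p]≡[m*o]*[n*p] i j (i ℕ.^ n) (j ℕ.^ n))

module Exponents (m : ℕ) where
  d E L : ℕ
  d = 3 ℕ.+ (m ℕ.+ m)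
  E = suc m ℕ.+ m ℕ.* d
  L = suc m ℕ.+ m

  numerator≡ : + (d ℕ.^ 2) ℤ.- + (2 ℕ.* d) ℤ.- + 1 ≡ + (2 ℕ.* E)
  numerator≡ = begin
    + (d ℕ.^ 2) ℤ.- + (2 ℕ.* d) ℤ.- + 1
      ≡⟨ cong (λ k → + k ℤ.- + (2 ℕ.* d) ℤ.- + 1) (d²≡2E+2d+1 m) ⟩
    + (2 ℕ.* E ℕ.+ 2 ℕ.* d ℕ.+ 1) ℤ.- + (2 ℕ.* d) ℤ.- + 1
      ≡⟨ ℤ.+-assoc (+ (2 ℕ.* E ℕ.+ 2 ℕ.* d ℕ.+ 1)) (ℤ.- + (2 ℕ.* d)) (ℤ.- + 1) ⟩
    + (2 ℕ.* E ℕ.+ 2 ℕ.* d ℕ.+ 1) ℤ.+ (ℤ.- + (2 ℕ.* d) ℤ.- + 1)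
      ≡⟨ cong₂ ℤ._+_ (cong +_ (ℕ.+-assoc (2 ℕ.* E) (2 ℕ.* d) 1))
           (sym (ℤ.neg-distrib-+ (+ (2 ℕ.* d)) (+ 1))) ⟩
    + (2 ℕ.* E) ℤ.+ + (2 ℕ.* d ℕ.+ 1) ℤ.- + (2 ℕ.* d ℕ.+ 1)
      ≡⟨ ℤ.+-assoc (+ (2 ℕ.* E)) (+ (2 ℕ.* d ℕ.+ 1)) (ℤ.- + (2 ℕ.* d ℕ.+ 1)) ⟩
    + (2 ℕ.* E) ℤ.+ (+ (2 ℕ.* d ℕ.+ 1) ℤ.- + (2 ℕ.* d ℕ.+ 1))
      ≡⟨ cong (λ i → + (2 ℕ.* E) ℤ.+ i) (ℤ.+-inverseʳ (+ (2 ℕ.* d ℕ.+ 1))) ⟩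
    + (2 ℕ.* E) ℤ.+ + 0
      ≡⟨ ℤ.+-identityʳ (+ (2 ℕ.* E)) ⟩
    + (2 ℕ.* E) ∎
    where open ≡-Reasoning

  denominator≡ : 2 ℕ.* d ℕ.∸ 4 ≡ 2 ℕ.* L
  denominator≡ = trans (cong (ℕ._∸ 4) (2d≡2L+4 m)) (ℕ.m+n∸n≡m (2 ℕ.* L) 4)

  bound : ℚ
  bound = + (2 ℕ.* E) / (2 ℕ.* L)

  0<bound : 0ℚ ℚ.< bound
  0<bound = ℚ.positive⁻¹ bound {{ℚ.normalize-pos (2 ℕ.* E) (2 ℕ.* L)}}

  -- After multiplication by κ = 2L this is `2E+1≡Ld`. The subtracted term `Z` is also the inverse
  -- of κ, which undoes the multiplication.
  bound-split : bound ≡ (+ d / 2) ℚ.- (+ 1 / (2 ℕ.* L))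
  bound-split = begin
    X
      ≡⟨ ℚ.*-identityˡ X ⟨
    1ℚ ℚ.* X
      ≡⟨ cong (ℚ._* X) κZ≡1 ⟨
    (κ ℚ.* Z) ℚ.* X
      ≡⟨ solveℚ 3 (λ κ Z X → (κ :* Z) :* X := Z :* (κ :* X)) refl κ Z X ⟩
    Z ℚ.* (κ ℚ.* X)
      ≡⟨ cong (Z ℚ.*_) κX≡κ[Y-Z] ⟩
    Z ℚ.* (κ ℚ.* (Y ℚ.- Z))
      ≡⟨ solveℚ 3 (λ κ Z X → Z :* (κ :* X) := (κ :* Z) :* X) refl κ Z (Y ℚ.- Z) ⟩
    (κ ℚ.* Z) ℚ.* (Y ℚ.- Z)
      ≡⟨ cong (ℚ._* (Y ℚ.- Z)) κZ≡1 ⟩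
    1ℚ ℚ.* (Y ℚ.- Z)
      ≡⟨ ℚ.*-identityˡ (Y ℚ.- Z) ⟩
    Y ℚ.- Z ∎
    where
    open ≡-Reasoning
    κ X Y Z : ℚ
    κ = ℤ→ℚ (+ (2 ℕ.* L))
    X = bound
    Y = + d / 2
    Z = + 1 / (2 ℕ.* L)
    κZ≡1 : κ ℚ.* Z ≡ 1ℚ
    κZ≡1 = k*[i/k]≡i (+ 1) (2 ℕ.* L)
    κX≡κ[Y-Z] : κ ℚ.* X ≡ κ ℚ.* (Y ℚ.- Z)
    κX≡κ[Y-Z] = begin
      κ ℚ.* X
        ≡⟨ k*[i/k]≡i (+ (2 ℕ.* E)) (2 ℕ.* L) ⟩
      ℤ→ℚ (+ (2 ℕ.* E))
        ≡⟨ solveℚ 1 (λ e → e := e :+ con 1ℚ :- con 1ℚ) refl (ℤ→ℚ (+ (2 ℕ.* E))) ⟩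
      ℤ→ℚ (+ (2 ℕ.* E)) ℚ.+ 1ℚ ℚ.- 1ℚ
        ≡⟨ cong (ℚ._- 1ℚ) (ℤ→ℚ-homo-+ (+ (2 ℕ.* E)) (+ 1)) ⟨
      ℤ→ℚ (+ (2 ℕ.* E ℕ.+ 1)) ℚ.- 1ℚ
        ≡⟨ cong (λ k → ℤ→ℚ (+ k) ℚ.- 1ℚ) (2E+1≡Ld m) ⟩
      ℤ→ℚ (+ (L ℕ.* d)) ℚ.- 1ℚ
        ≡⟨ cong₂ ℚ._-_ (trans (ℤ→ℚ-pos-* L d)
             (cong (ℤ→ℚ (+ L) ℚ.*_) (sym (k*[i/k]≡i (+ d) 2)))) (sym κZ≡1) ⟩
      ℤ→ℚ (+ L) ℚ.* (ℤ→ℚ (+ 2) ℚ.* Y) ℚ.- κ ℚ.* Z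
        ≡⟨ solveℚ 5 (λ l t Y κ Z → l :* (t :* Y) :- κ :* Z := (t :* l) :* Y :- κ :* Z)
             refl (ℤ→ℚ (+ L)) (ℤ→ℚ (+ 2)) Y κ Z ⟩
      (ℤ→ℚ (+ 2) ℚ.* ℤ→ℚ (+ L)) ℚ.* Y ℚ.- κ ℚ.* Z
        ≡⟨ cong (λ c → c ℚ.* Y ℚ.- κ ℚ.* Z) (ℤ→ℚ-pos-* 2 L) ⟨
      κ ℚ.* Y ℚ.- κ ℚ.* Z
        ≡⟨ CauchyLemmas.*-distribˡ-diff κ Y Z ⟨
      κ ℚ.* (Y ℚ.- Z) ∎

  <bound⇒ : ∀ {N} q → ℚ.↥ q ≡ + N → q ℚ.< bound → L ℕ.* N ℕ.< E ℕ.* ℚ.↧ₙ q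
  <bound⇒ {N} q ↥q≡N q<bound =
    ℕ.*-cancelˡ-< 2 (L ℕ.* N) (E ℕ.* D)
      (subst₂ ℕ._<_ (ℕ.*-assoc 2 L N) (ℕ.*-assoc 2 E D) (ℤ.drop‿+<+ (ℤ→ℚ-cancel-< cross)))
    where
    open ℚ.≤-Reasoning
    D = ℚ.↧ₙ q
    κ δ : ℚ
    κ = ℤ→ℚ (+ (2 ℕ.* L))
    δ = ℤ→ℚ (+ D)
    κδ-pos : ℚ.Positive (κ ℚ.* δ)
    κδ-pos = positive (0<* (pos (2 ℕ.* L)) (pos D))
      where
      pos : ∀ k .{{_ : ℕ.NonZero k}} → 0ℚ ℚ.< ℤ→ℚ (+ k)
      pos k = ℚ.positive⁻¹ (ℤ→ℚ (+ k)) {{ℚ.normalize-pos k 1}}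
    cross : ℤ→ℚ (+ (2 ℕ.* L ℕ.* N)) ℚ.< ℤ→ℚ (+ (2 ℕ.* E ℕ.* D))
    cross = begin-strict
      ℤ→ℚ (+ (2 ℕ.* L ℕ.* N))        ≡⟨ ℤ→ℚ-pos-* (2 ℕ.* L) N ⟩
      κ ℚ.* ℤ→ℚ (+ N)                ≡⟨ cong (λ i → κ ℚ.* ℤ→ℚ i) ↥q≡N ⟨
      κ ℚ.* ℤ→ℚ (ℚ.↥ q)              ≡⟨ cong (κ ℚ.*_) (↧*p≡↥ q) ⟨
      κ ℚ.* (δ ℚ.* q)                ≡⟨ ℚ.*-assoc κ δ q ⟨
      (κ ℚ.* δ) ℚ.* q                <⟨ ℚ.*-monoʳ-<-pos (κ ℚ.* δ) {{κδ-pos}} q<bound ⟩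
      (κ ℚ.* δ) ℚ.* bound            ≡⟨ solveℚ 3 (λ κ δ b → (κ :* δ) :* b := (κ :* b) :* δ) refl κ δ bound ⟩
      (κ ℚ.* bound) ℚ.* δ            ≡⟨ cong (ℚ._* δ) (k*[i/k]≡i (+ (2 ℕ.* E)) (2 ℕ.* L)) ⟩
      ℤ→ℚ (+ (2 ℕ.* E)) ℚ.* δ        ≡⟨ ℤ→ℚ-pos-* (2 ℕ.* E) D ⟨
      ℤ→ℚ (+ (2 ℕ.* E ℕ.* D))        ∎

  -- For q = N / D the strict inequality L N < E D leaves one spare factor `a`. It absorbs 3ᴺ from
  -- the height bound and 3ᴰ from the distance 3ρ.
  power-comparison : ∀ a N D {h} .{{_ : ℕ.NonZero a}} → 3 ℕ.^ (D ℕ.+ N) ℕ.≤ a →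
    L ℕ.* N ℕ.< E ℕ.* D → h ℕ.≤ 3 ℕ.* a ℕ.^ L → 3 ℕ.^ D ℕ.* h ℕ.^ N ℕ.≤ a ℕ.^ (E ℕ.* D)
  power-comparison a N D {h} 3^≤a LN<ED h≤ = begin
    3 ℕ.^ D ℕ.* h ℕ.^ N
      ≤⟨ ℕ.*-monoʳ-≤ (3 ℕ.^ D) (ℕ.^-monoˡ-≤ N h≤) ⟩
    3 ℕ.^ D ℕ.* (3 ℕ.* a ℕ.^ L) ℕ.^ N
      ≡⟨ cong (3 ℕ.^ D ℕ.*_) (ℕ-^-distribʳ-* N 3 (a ℕ.^ L)) ⟩
    3 ℕ.^ D ℕ.* (3 ℕ.^ N ℕ.* (a ℕ.^ L) ℕ.^ N)
      ≡⟨ cong (λ c → 3 ℕ.^ D ℕ.* (3 ℕ.^ N ℕ.* c)) (ℕ.^-*-assoc a L N) ⟩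
    3 ℕ.^ D ℕ.* (3 ℕ.^ N ℕ.* a ℕ.^ (L ℕ.* N))
      ≡⟨ ℕ.*-assoc (3 ℕ.^ D) (3 ℕ.^ N) _ ⟨
    3 ℕ.^ D ℕ.* 3 ℕ.^ N ℕ.* a ℕ.^ (L ℕ.* N)
      ≡⟨ cong (ℕ._* a ℕ.^ (L ℕ.* N)) (ℕ.^-distribˡ-+-* 3 D N) ⟨
    3 ℕ.^ (D ℕ.+ N) ℕ.* a ℕ.^ (L ℕ.* N)
      ≤⟨ ℕ.*-monoˡ-≤ (a ℕ.^ (L ℕ.* N)) 3^≤a ⟩
    a ℕ.^ suc (L ℕ.* N)
      ≤⟨ ℕ.^-monoʳ-≤ a LN<ED ⟩
    a ℕ.^ (E ℕ.* D) ∎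
    where open ℕ.≤-Reasoning

  module _ (H N D : ℕ) where

    -- A sum of three lower bounds: one for the contraction, one for a height of at least `H`, and
    -- one for the constants in `power-comparison`.
    a : ℕ
    a = 2 ℕ.* (5 ℕ.+ (m ℕ.+ m)) ℕ.+ (H ℕ.+ 3 ℕ.^ (D ℕ.+ N))

    large : 2 ℕ.* (5 ℕ.+ (m ℕ.+ m)) ℕ.≤ a
    large = ℕ.m≤m+n (2 ℕ.* (5 ℕ.+ (m ℕ.+ m))) (H ℕ.+ 3 ℕ.^ (D ℕ.+ N))

    H≤a : H ℕ.≤ a
    H≤a = ℕ.≤-trans (ℕ.m≤m+n H (3 ℕ.^ (D ℕ.+ N))) (ℕ.m≤n+m _ (2 ℕ.* (5 ℕ.+ (m ℕ.+ m))))

    3^≤a : 3 ℕ.^ (D ℕ.+ N) ℕ.≤ a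
    3^≤a = ℕ.≤-trans (ℕ.m≤n+m (3 ℕ.^ (D ℕ.+ N)) H) (ℕ.m≤n+m _ (2 ℕ.* (5 ℕ.+ (m ℕ.+ m))))

    w : ℚ
    w = ℤ→ℚ (+ a)

    instance
      w-pos : ℚ.Positive w
      w-pos = ℚ.normalize-pos a 1
      w-nonZero : ℚ.NonZero w
      w-nonZero = ℚ.pos⇒nonZero w

    open Roots a m large (ℚ.1/ w) (ℚ.positive⁻¹ (ℚ.1/ w) {{ℚ.1/pos⇒pos w}}) (ℚ.*-inverseʳ w)

    distinct : DistinctRoots (family a m) (ℝ→ℂ α) (ℝ→ℂ β)
    distinct = α-root , β-root , α≉β

    polynomial : MonicReducible d H
    polynomial = record
      { poly             = family a m
      ; monic            = leading⇒monic (leading-mul (factorB a m) (factorA a m)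
                             (factorB-leading a m) (factorA-leading a m))
      ; reducible        = mul-reducible (factorB a m) (factorA a m) (ℕ.s≤s ℕ.z≤n) (ℕ.s≤s ℕ.z≤n)
                             (proj₁ (leading⇒monic (factorB-leading a m)))
                             (proj₁ (leading⇒monic (factorA-leading a m)))
      ; hasDistinctRoots = ℝ→ℂ α , ℝ→ℂ β , distinct
      ; height>1         = ℕ.≤-trans (ℕ.≤-trans (ℕ.m≤m*n 2 (5 ℕ.+ (m ℕ.+ m))) large)
                             (height-family-≥ a m)
      ; height≥          = ℕ.≤-trans H≤a (height-family-≥ a m)
      }

    ρ≡u^E : ρ ≡ (ℚ.1/ w) ^ℚ E
    ρ≡u^E = trans (cong ((ℚ.1/ w) ^ℚ suc m ℚ.*_) (^-assocʳ (ℚ.1/ w) m d))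
      (sym (^-homo-* (ℚ.1/ w) (suc m) (m ℕ.* d)))

    height-bound : L ℕ.* N ℕ.< E ℕ.* D →
      (ℤ→ℚ (+ 3) ℚ.* ρ) ^ℚ D ℚ.* ℤ→ℚ (+ (height (family a m) ℕ.^ N)) ℚ.≤ 1ℚ
    height-bound LN<ED = begin
      (ℤ→ℚ (+ 3) ℚ.* ρ) ^ℚ D ℚ.* h
        ≡⟨ cong (λ c → (ℤ→ℚ (+ 3) ℚ.* c) ^ℚ D ℚ.* h) ρ≡u^E ⟩
      (ℤ→ℚ (+ 3) ℚ.* u ^ℚ E) ^ℚ D ℚ.* h
        ≡⟨ cong (ℚ._* h) (^-distrib-* (ℤ→ℚ (+ 3)) (u ^ℚ E) D) ⟩
      (ℤ→ℚ (+ 3) ^ℚ D ℚ.* (u ^ℚ E) ^ℚ D) ℚ.* h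
        ≡⟨ cong₂ (λ s t → (s ℚ.* t) ℚ.* h) (sym (ℤ→ℚ-homo-^ 3 D)) (^-assocʳ u E D) ⟩
      (ℤ→ℚ (+ (3 ℕ.^ D)) ℚ.* U) ℚ.* h
        ≡⟨ solveℚ 3 (λ s t h → (s :* t) :* h := (s :* h) :* t) refl (ℤ→ℚ (+ (3 ℕ.^ D))) U h ⟩
      (ℤ→ℚ (+ (3 ℕ.^ D)) ℚ.* h) ℚ.* U
        ≡⟨ cong (ℚ._* U) (ℤ→ℚ-pos-* (3 ℕ.^ D) (height (family a m) ℕ.^ N)) ⟨
      ℤ→ℚ (+ (3 ℕ.^ D ℕ.* height (family a m) ℕ.^ N)) ℚ.* U
        ≤⟨ *-monoʳ U (0≤^ (E ℕ.* D) 0≤u) (ℤ→ℚ-mono-≤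
             {+ (3 ℕ.^ D ℕ.* height (family a m) ℕ.^ N)} {+ (a ℕ.^ (E ℕ.* D))}
             (ℤ.+≤+ (power-comparison a N D 3^≤a LN<ED (height-family-≤ a m)))) ⟩
      ℤ→ℚ (+ (a ℕ.^ (E ℕ.* D))) ℚ.* U
        ≡⟨ cong (ℚ._* U) (ℤ→ℚ-homo-^ a (E ℕ.* D)) ⟩
      w ^ℚ (E ℕ.* D) ℚ.* U
        ≡⟨ w^*u^≡1 (E ℕ.* D) ⟩
      1ℚ ∎
      where
      open ℚ.≤-Reasoning
      u U h : ℚ
      u = ℚ.1/ w
      U = u ^ℚ (E ℕ.* D)
      h = ℤ→ℚ (+ (height (family a m) ℕ.^ N))

    separated : sep (family a m) (ℤ→ℚ (+ 3) ℚ.* ρ)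
    separated = ℝ→ℂ α , ℝ→ℂ β , distinct , distance<3ρ

  -- The rational between the separation and the power of the height is 3ρ, found by unification
  -- from `separated`. Positivity of `q` selects the clause of `_≤_^-_` for a nonnegative numerator.
  attained : ∀ q → 0ℚ ℚ.< q → q ℚ.< bound → ∀ H →
    sup {MonicReducible d H} (λ P → e (MonicReducible.poly P)) q
  attained (ℚ.mkℚ -[1+ n ] _ _) (ℚ.*<* ()) _ _
  attained q@(ℚ.mkℚ (+ N) D-1 _) _ q<bound H =
    polynomial H N (suc D-1) , _ , separated H N (suc D-1) ,
    height-bound H N (suc D-1) (<bound⇒ q refl q<bound)

  -- The lower limit asks for a rational strictly above `q`, and `attained` for a positive one below
  -- the bound; density above max(q, 0) gives both. Every `H` is served, so the threshold is 0.
  e*ᵣ≥bound : e*ᵣ d ≥ᶜ bound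
  e*ᵣ≥bound q q<bound = q′ , ℚ.≤-<-trans (ℚ.p≤p⊔q q 0ℚ) max<q′ , 0 , λ H _ →
    attained q′ (ℚ.≤-<-trans (ℚ.p≤q⊔p q 0ℚ) max<q′) q′<bound H
    where
    max<bound : q ℚ.⊔ 0ℚ ℚ.< bound
    max<bound with ℚ.⊔-sel q 0ℚ
    ... | inj₁ max≡q = subst (ℚ._< bound) (sym max≡q) q<bound
    ... | inj₂ max≡0 = subst (ℚ._< bound) (sym max≡0) 0<bound
    between : ∃[ q′ ] q ℚ.⊔ 0ℚ ℚ.< q′ × q′ ℚ.< bound
    between = ℚ.<-dense max<bound
    q′ : ℚ
    q′ = proj₁ between
    max<q′ : q ℚ.⊔ 0ℚ ℚ.< q′
    max<q′ = proj₁ (proj₂ between)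
    q′<bound : q′ ℚ.< bound
    q′<bound = proj₂ (proj₂ between)

-- Odd degrees and the conclusion

odd⇒1+j+j : ∀ d → ¬ (2 ∣ d) → ∃[ j ] d ≡ suc (j ℕ.+ j)
odd⇒1+j+j zero          odd = contradiction (2 ∣0) odd
odd⇒1+j+j (suc zero)    odd = 0 , refl
odd⇒1+j+j (suc (suc d)) odd with odd⇒1+j+j d (λ 2∣d → odd (∣m∣n⇒∣m+n ∣-refl 2∣d))
... | j , refl = suc j , cong (λ k → suc (suc k)) (sym (ℕ.+-suc j j))

odd≥5⇒3+m+m : ∀ d → 5 ℕ.≤ d → ¬ (2 ∣ d) → ∃[ m ] d ≡ 3 ℕ.+ (m ℕ.+ m)
odd≥5⇒3+m+m d 5≤d odd with odd⇒1+j+j d odd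
odd≥5⇒3+m+m _ (ℕ.s≤s ()) odd | zero , refl
... | suc m , refl = m , cong (λ k → suc (suc k)) (ℕ.+-suc m m)

mainTheorem2 : (d : ℕ) (5≤d : 5 ℕ.≤ d) → ¬ (2 ∣ d) →
    let instance 2d∸4≢0 = 2d∸4-nonZero 5≤d
        bound = (+ (d ℕ.^ 2) ℤ.- + (2 ℕ.* d) ℤ.- + 1) / (2 ℕ.* d ℕ.∸ 4)
    in (e*ᵣ d ≥ᶜ bound) × (bound ≡ (+ d / 2) ℚ.- (+ 1 / (2 ℕ.* d ℕ.∸ 4)))
mainTheorem2 d 5≤d odd with odd≥5⇒3+m+m d 5≤d odd
... | m , refl =
  subst (e*ᵣ d ≥ᶜ_) (sym bound≡) e*ᵣ≥bound ,
  trans bound≡ (trans bound-split (cong (λ y → (+ d / 2) ℚ.- y)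
    (ℚ./-cong {+ 1} {2 ℕ.* L} {+ 1} {2 ℕ.* d ℕ.∸ 4} refl (sym denominator≡))))
  where
  open Exponents m using (L; bound-split; numerator≡; denominator≡; e*ᵣ≥bound) renaming (bound to bound′)
  instance
    2d∸4≢0 : ℕ.NonZero (2 ℕ.* d ℕ.∸ 4)
    2d∸4≢0 = 2d∸4-nonZero 5≤d
  bound≡ : (+ (d ℕ.^ 2) ℤ.- + (2 ℕ.* d) ℤ.- + 1) / (2 ℕ.* d ℕ.∸ 4) ≡ bound′
  bound≡ = ℚ./-cong numerator≡ denominator≡
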